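{- Let $b\in\{2,3,4\}$, and for each positive integer $n$ let $F_b(n)$ be the number of nice Friedman numbers in base $b$ lying in $[1,n]$. Then $$\lim_{n\to\infty}\frac{F_b(n)}{n}=1.$$ That is, in binary, ternary and base four the density of nice Friedman numbers is $1$.
   Context: Fix an integer base $b\ge 2$. A base-$b$ digit is an element of $\{0,1,\dots,b-1\}$. For a finite nonempty string $s=d_1d_2\cdots d_l$ of base-$b$ digits, an order-preserving calculation from the digits of $s$ is an expression obtained as follows. Split $s$ into consecutive nonempty blocks. Read each block as a nonnegative integer written in base $b$ (this is digit concatenation; leading zeros are allowed). Then combine these integers, kept in their original left-to-right order and each used exactly once, by the binary operations $x+y$, $x-y$, $x\times y$, $x/y$, $x^y$, with arbitrary parenthesization. Unary negation may also be applied to any subexpression (for example $127=-1+2^7$ in base ten). Concatenation is applied only to digits, never to results of other operations. Expressions are evaluated in the real numbers, and expressions involving an undefined operation (such as division by zero) are discarded. A positive integer $n$ is a nice Friedman number in base $b$ if $n$ is the value of some order-preserving calculation from the digits of the base-$b$ representation of $n$ (without leading zeros) in which digit concatenation is not the only operation used, i.e. at least one of the five binary operations $+,-,\times,/$, exponentiation occurs in it. -}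

module Defs where

open import Data.Digit using (Digit; fromDigits)
open import Data.Fin.Base using (toℕ)
open import Data.Integer.Base as ℤ using (ℤ; -[1+_])
open import Data.List.Base using (reverse)
open import Data.List.NonEmpty.Base using (List⁺; head; toList; _⁺++⁺_)
open import Data.Nat.Base as ℕ using (ℕ; zero; suc)
import Data.Nat.Properties as ℕₚ
open import Data.Product.Base using (Σ; ∃-syntax; _×_; _,_)
open import Data.Empty using (⊥; ⊥-elim)
open import Data.Rational.Base as ℚ using (ℚ; 0ℚ; 1ℚ; ½; Positive; positive)
import Data.Rational.Properties as ℚₚ
open import Data.Rational.Solver using (module +-*-Solver)
open import Data.Unit.Base using (⊤)
open import Relation.Binary.PropositionalEquality
  using (_≡_; _≢_; refl; sym; trans; cong; cong₂; subst)
open import Relation.Nullary.Negation using (¬_)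

IsCauchy : (ℕ → ℚ) → Set
IsCauchy f = ∀ ε → 0ℚ ℚ.< ε →
  ∃[ N ] ∀ m n → N ℕ.≤ m → N ℕ.≤ n → ℚ.∣ f m ℚ.- f n ∣ ℚ.< ε

record ℝ : Set where
  constructor mkℝ
  field
    seq    : ℕ → ℚ
    cauchy : IsCauchy seq

open ℝ public

private
  half-pos : ∀ {ε} → 0ℚ ℚ.< ε → 0ℚ ℚ.< ½ ℚ.* ε
  half-pos {ε} 0<ε =
    subst (ℚ._< ½ ℚ.* ε) (ℚₚ.*-zeroʳ ½) (ℚₚ.*-monoʳ-<-pos ½ 0<ε)

  half+half : ∀ ε → ½ ℚ.* ε ℚ.+ ½ ℚ.* ε ≡ ε
  half+half ε = trans (sym (ℚₚ.*-distribʳ-+ ε ½ ½)) (ℚₚ.*-identityˡ ε)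

  ∣q-q∣<ε : ∀ q {ε} → 0ℚ ℚ.< ε → ℚ.∣ q ℚ.- q ∣ ℚ.< ε
  ∣q-q∣<ε q {ε} 0<ε =
    subst (λ z → ℚ.∣ z ∣ ℚ.< ε) (sym (ℚₚ.+-inverseʳ q)) 0<ε

  module _ where
    open +-*-Solver

    sum-rearrange : ∀ a b c d → (a ℚ.+ b) ℚ.- (c ℚ.+ d) ≡ (a ℚ.- c) ℚ.+ (b ℚ.- d)
    sum-rearrange = solve 4
      (λ a b c d → (a :+ b) :- (c :+ d) := (a :- c) :+ (b :- d)) refl

    neg-rearrange : ∀ a b → (ℚ.- a) ℚ.- (ℚ.- b) ≡ ℚ.- (a ℚ.- b)
    neg-rearrange = solve 2 (λ a b → (:- a) :- (:- b) := :- (a :- b)) refl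

    prod-rearrange : ∀ a b c d →
      a ℚ.* b ℚ.- c ℚ.* d ≡ a ℚ.* (b ℚ.- d) ℚ.+ d ℚ.* (a ℚ.- c)
    prod-rearrange = solve 4
      (λ a b c d → a :* b :- c :* d := a :* (b :- d) :+ d :* (a :- c)) refl

    cancel-mid : ∀ a b → (a ℚ.- b) ℚ.+ b ≡ a
    cancel-mid = solve 2 (λ a b → (a :- b) :+ b := a) refl

  bounded : (x : ℝ) →
            ∃[ B ] 0ℚ ℚ.< B × ∃[ N ] ∀ n → N ℕ.≤ n → ℚ.∣ seq x n ∣ ℚ.≤ B
  bounded x with cauchy x 1ℚ (ℚₚ.positive⁻¹ 1ℚ)
  ... | N , h = 1ℚ ℚ.+ A , 0<B , N , bound
    where
    A = ℚ.∣ seq x N ∣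

    0<B : 0ℚ ℚ.< 1ℚ ℚ.+ A
    0<B = ℚₚ.+-mono-<-≤ (ℚₚ.positive⁻¹ 1ℚ) (ℚₚ.0≤∣p∣ (seq x N))

    bound : ∀ n → N ℕ.≤ n → ℚ.∣ seq x n ∣ ℚ.≤ 1ℚ ℚ.+ A
    bound n N≤n = begin
      ℚ.∣ seq x n ∣                              ≡⟨ cong ℚ.∣_∣ (cancel-mid (seq x n) (seq x N)) ⟨
      ℚ.∣ (seq x n ℚ.- seq x N) ℚ.+ seq x N ∣    ≤⟨ ℚₚ.∣p+q∣≤∣p∣+∣q∣ (seq x n ℚ.- seq x N) (seq x N) ⟩
      ℚ.∣ seq x n ℚ.- seq x N ∣ ℚ.+ A            ≤⟨ ℚₚ.+-monoˡ-≤ A (ℚₚ.<⇒≤ (h n N N≤n ℕₚ.≤-refl)) ⟩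
      1ℚ ℚ.+ A                                   ∎
      where open ℚₚ.≤-Reasoning

  scale : ∀ {B ε} → 0ℚ ℚ.< B → 0ℚ ℚ.< ε → ∃[ δ ] 0ℚ ℚ.< δ × B ℚ.* δ ≡ ε
  scale {B} {ε} 0<B 0<ε = 1/B ℚ.* ε , 0<δ , eq
    where
    instance
      B-pos : Positive B
      B-pos = positive 0<B
      B≢0 : ℚ.NonZero B
      B≢0 = ℚₚ.pos⇒nonZero B
    1/B = ℚ.1/ B
    0<δ : 0ℚ ℚ.< 1/B ℚ.* ε
    0<δ = subst (ℚ._< 1/B ℚ.* ε) (ℚₚ.*-zeroʳ 1/B)
            (ℚₚ.*-monoʳ-<-pos 1/B {{ℚₚ.1/pos⇒pos B}} 0<ε)
    eq : B ℚ.* (1/B ℚ.* ε) ≡ ε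
    eq = trans (sym (ℚₚ.*-assoc B 1/B ε))
           (trans (cong (ℚ._* ε) (ℚₚ.*-inverseʳ B)) (ℚₚ.*-identityˡ ε))

  ∣p*q∣-small : ∀ {p q B δ} → 0ℚ ℚ.< B → ℚ.∣ p ∣ ℚ.≤ B → ℚ.∣ q ∣ ℚ.< δ →
                ℚ.∣ p ℚ.* q ∣ ℚ.< B ℚ.* δ
  ∣p*q∣-small {p} {q} {B} {δ} 0<B p≤B q<δ = begin-strict
    ℚ.∣ p ℚ.* q ∣        ≡⟨ ℚₚ.∣p*q∣≡∣p∣*∣q∣ p q ⟩
    ℚ.∣ p ∣ ℚ.* ℚ.∣ q ∣  ≤⟨ ℚₚ.*-monoʳ-≤-nonNeg ℚ.∣ q ∣ {{ℚ.nonNegative (ℚₚ.0≤∣p∣ q)}} p≤B ⟩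
    B ℚ.* ℚ.∣ q ∣        <⟨ ℚₚ.*-monoʳ-<-pos B {{positive 0<B}} q<δ ⟩
    B ℚ.* δ              ∎
    where open ℚₚ.≤-Reasoning

  sum-small : ∀ a b c d {ε} →
              ℚ.∣ a ℚ.- c ∣ ℚ.< ½ ℚ.* ε → ℚ.∣ b ℚ.- d ∣ ℚ.< ½ ℚ.* ε →
              ℚ.∣ (a ℚ.+ b) ℚ.- (c ℚ.+ d) ∣ ℚ.< ε
  sum-small a b c d {ε} ac bd = begin-strict
    ℚ.∣ (a ℚ.+ b) ℚ.- (c ℚ.+ d) ∣          ≡⟨ cong ℚ.∣_∣ (sum-rearrange a b c d) ⟩
    ℚ.∣ (a ℚ.- c) ℚ.+ (b ℚ.- d) ∣          ≤⟨ ℚₚ.∣p+q∣≤∣p∣+∣q∣ (a ℚ.- c) (b ℚ.- d) ⟩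
    ℚ.∣ a ℚ.- c ∣ ℚ.+ ℚ.∣ b ℚ.- d ∣        <⟨ ℚₚ.+-mono-< ac bd ⟩
    ½ ℚ.* ε ℚ.+ ½ ℚ.* ε                    ≡⟨ half+half ε ⟩
    ε                                      ∎
    where open ℚₚ.≤-Reasoning

  prod-small : ∀ a b c d {A B α β ε} → 0ℚ ℚ.< A → 0ℚ ℚ.< B →
               A ℚ.* α ≡ ½ ℚ.* ε → B ℚ.* β ≡ ½ ℚ.* ε →
               ℚ.∣ a ∣ ℚ.≤ A → ℚ.∣ d ∣ ℚ.≤ B →
               ℚ.∣ a ℚ.- c ∣ ℚ.< β → ℚ.∣ b ℚ.- d ∣ ℚ.< α →
               ℚ.∣ a ℚ.* b ℚ.- c ℚ.* d ∣ ℚ.< ε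
  prod-small a b c d {A} {B} {α} {β} {ε} 0<A 0<B Aα≡ Bβ≡ a≤A d≤B ac bd = begin-strict
    ℚ.∣ a ℚ.* b ℚ.- c ℚ.* d ∣
      ≡⟨ cong ℚ.∣_∣ (prod-rearrange a b c d) ⟩
    ℚ.∣ a ℚ.* (b ℚ.- d) ℚ.+ d ℚ.* (a ℚ.- c) ∣
      ≤⟨ ℚₚ.∣p+q∣≤∣p∣+∣q∣ (a ℚ.* (b ℚ.- d)) (d ℚ.* (a ℚ.- c)) ⟩
    ℚ.∣ a ℚ.* (b ℚ.- d) ∣ ℚ.+ ℚ.∣ d ℚ.* (a ℚ.- c) ∣
      <⟨ ℚₚ.+-mono-< (∣p*q∣-small {a} {b ℚ.- d} 0<A a≤A bd)
                     (∣p*q∣-small {d} {a ℚ.- c} 0<B d≤B ac) ⟩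
    A ℚ.* α ℚ.+ B ℚ.* β
      ≡⟨ cong₂ ℚ._+_ Aα≡ Bβ≡ ⟩
    ½ ℚ.* ε ℚ.+ ½ ℚ.* ε
      ≡⟨ half+half ε ⟩
    ε ∎
    where open ℚₚ.≤-Reasoning

abstract

  const-cauchy : ∀ q → IsCauchy (λ _ → q)
  const-cauchy q ε 0<ε = 0 , λ _ _ _ _ → ∣q-q∣<ε q 0<ε

  +-cauchy : ∀ x y → IsCauchy (λ n → seq x n ℚ.+ seq y n)
  +-cauchy x y ε 0<ε =
    let M , hx = cauchy x (½ ℚ.* ε) (half-pos 0<ε)
        N , hy = cauchy y (½ ℚ.* ε) (half-pos 0<ε)
    in M ℕ.⊔ N , λ m n ≤m ≤n →
       sum-small (seq x m) (seq y m) (seq x n) (seq y n)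
         (hx m n (ℕₚ.m⊔n≤o⇒m≤o M N ≤m) (ℕₚ.m⊔n≤o⇒m≤o M N ≤n))
         (hy m n (ℕₚ.m⊔n≤o⇒n≤o M N ≤m) (ℕₚ.m⊔n≤o⇒n≤o M N ≤n))

  neg-cauchy : ∀ x → IsCauchy (λ n → ℚ.- seq x n)
  neg-cauchy x ε 0<ε = let N , h = cauchy x ε 0<ε in
    N , λ m n N≤m N≤n → subst (ℚ._< ε)
      (sym (trans (cong ℚ.∣_∣ (neg-rearrange (seq x m) (seq x n)))
                  (ℚₚ.∣-p∣≡∣p∣ (seq x m ℚ.- seq x n))))
      (h m n N≤m N≤n)

  *-cauchy : ∀ x y → IsCauchy (λ n → seq x n ℚ.* seq y n)
  *-cauchy x y ε 0<ε =
    let A , 0<A , K , x≤A = bounded x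
        B , 0<B , L , y≤B = bounded y
        α , 0<α , Aα≡ = scale 0<A (half-pos 0<ε)
        β , 0<β , Bβ≡ = scale 0<B (half-pos 0<ε)
        M , hx = cauchy x β 0<β
        N , hy = cauchy y α 0<α
    in (K ℕ.⊔ L) ℕ.⊔ (M ℕ.⊔ N) , λ m n ≤m ≤n →
       let KL≤m = ℕₚ.m⊔n≤o⇒m≤o (K ℕ.⊔ L) (M ℕ.⊔ N) ≤m
           KL≤n = ℕₚ.m⊔n≤o⇒m≤o (K ℕ.⊔ L) (M ℕ.⊔ N) ≤n
           MN≤m = ℕₚ.m⊔n≤o⇒n≤o (K ℕ.⊔ L) (M ℕ.⊔ N) ≤m
           MN≤n = ℕₚ.m⊔n≤o⇒n≤o (K ℕ.⊔ L) (M ℕ.⊔ N) ≤n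
       in prod-small (seq x m) (seq y m) (seq x n) (seq y n) 0<A 0<B Aα≡ Bβ≡
            (x≤A m (ℕₚ.m⊔n≤o⇒m≤o K L KL≤m))
            (y≤B n (ℕₚ.m⊔n≤o⇒n≤o K L KL≤n))
            (hx m n (ℕₚ.m⊔n≤o⇒m≤o M N MN≤m) (ℕₚ.m⊔n≤o⇒m≤o M N MN≤n))
            (hy m n (ℕₚ.m⊔n≤o⇒n≤o M N MN≤m) (ℕₚ.m⊔n≤o⇒n≤o M N MN≤n))

fromℚ : ℚ → ℝ
fromℚ q = mkℝ (λ _ → q) (const-cauchy q)

fromℤ : ℤ → ℝ
fromℤ k = fromℚ (k ℚ./ 1)

fromℕ : ℕ → ℝ
fromℕ n = fromℤ (ℤ.+ n)

0ℝ 1ℝ : ℝ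
0ℝ = fromℚ 0ℚ
1ℝ = fromℚ 1ℚ

infix  8 -_
infixl 7 _*_
infixl 6 _+_ _-_

_+_ : ℝ → ℝ → ℝ
x + y = mkℝ (λ n → seq x n ℚ.+ seq y n) (+-cauchy x y)

-_ : ℝ → ℝ
- x = mkℝ (λ n → ℚ.- seq x n) (neg-cauchy x)

_-_ : ℝ → ℝ → ℝ
x - y = x + (- y)

_*_ : ℝ → ℝ → ℝ
x * y = mkℝ (λ n → seq x n ℚ.* seq y n) (*-cauchy x y)

infix 4 _≈_ _≉_ _<_

_≈_ : ℝ → ℝ → Set
x ≈ y = ∀ ε → 0ℚ ℚ.< ε →
        ∃[ N ] ∀ n → N ℕ.≤ n → ℚ.∣ seq x n ℚ.- seq y n ∣ ℚ.< ε

_≉_ : ℝ → ℝ → Set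
x ≉ y = ¬ (x ≈ y)

-- The uniform gap ε is what makes this the strict order of the limits.
_<_ : ℝ → ℝ → Set
x < y = ∃[ ε ] 0ℚ ℚ.< ε × ∃[ N ] ∀ n → N ℕ.≤ n → seq x n ℚ.+ ε ℚ.< seq y n

∣_-_∣<_ : ℝ → ℝ → ℚ → Set
∣ x - y ∣< ε = (x - y < fromℚ ε) × (y - x < fromℚ ε)

Quotient : ℝ → ℝ → ℝ → Set
Quotient x y z = (y ≉ 0ℝ) × (z * y ≈ x)

infixr 8 _^_

_^_ : ℝ → ℕ → ℝ
x ^ zero  = 1ℝ
x ^ suc n = x * x ^ n

-- "z is x ^ k", for x ≉ 0
IntegerPower : ℝ → ℤ → ℝ → Set
IntegerPower x (ℤ.+ n)  z = z ≈ x ^ n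
IntegerPower x -[1+ n ] z = z * x ^ suc n ≈ 1ℝ

-- "z is x ^ (p / q)", for x > 0: the positive real z with z ^ q = x ^ p
RationalPower : ℝ → ℚ → ℝ → Set
RationalPower x r z = (0ℝ < z) × IntegerPower x (ℚ.numerator r) (z ^ ℚ.denominatorℕ r)

-- "z is x ^ y", for x > 0: the limit of x ^ r as the rational r tends to y
RealPower : ℝ → ℝ → ℝ → Set
RealPower x y z =
  ∀ ε → 0ℚ ℚ.< ε → ∃[ δ ] 0ℚ ℚ.< δ ×
    (∀ r w → ∣ fromℚ r - y ∣< δ → RationalPower x r w → ∣ w - z ∣< ε)

-- Graph of real exponentiation.  A nonzero base may be raised to any integer,
-- a positive base to any real (consistently where both apply), and 0 to any
-- positive real.  Hence 0 ^ 0, 0 ^ y for y < 0, and x ^ y for x < 0 and y not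
-- an integer are undefined.
data Power (x y z : ℝ) : Set where
  integerExponent : ∀ k → x ≉ 0ℝ → y ≈ fromℤ k → IntegerPower x k z → Power x y z
  positiveBase    : 0ℝ < x → RealPower x y z → Power x y z
  zeroBase        : x ≈ 0ℝ → 0ℝ < y → z ≈ 0ℝ → Power x y z

-- Digit strings are written with the most significant digit first, whereas
-- fromDigits expects the least significant digit first.
value : ∀ {b} → List⁺ (Digit b) → ℕ
value s = fromDigits (reverse (toList s))

data Op : Set where
  add sub mul div pow : Op

data Expr (b : ℕ) : Set where
  block  : List⁺ (Digit b) → Expr b
  negate : Expr b → Expr b
  binary : Op → Expr b → Expr b → Expr b

-- An order-preserving calculation from the digits of s is an e with digits e ≡ s.
digits : ∀ {b} → Expr b → List⁺ (Digit b)
digits (block s)        = s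
digits (negate e)       = digits e
digits (binary _ e₁ e₂) = digits e₁ ⁺++⁺ digits e₂

UsesBinary : ∀ {b} → Expr b → Set
UsesBinary (block _)      = ⊥
UsesBinary (negate e)     = UsesBinary e
UsesBinary (binary _ _ _) = ⊤

OpGraph : Op → ℝ → ℝ → ℝ → Set
OpGraph add x y z = z ≈ x + y
OpGraph sub x y z = z ≈ x - y
OpGraph mul x y z = z ≈ x * y
OpGraph div       = Quotient
OpGraph pow       = Power

infix 4 _⇓_

-- e ⇓ x : every operation in e is defined and the value of e is x
data _⇓_ {b : ℕ} : Expr b → ℝ → Set where
  ⇓block  : ∀ {s x} → x ≈ fromℕ (value s) → block s ⇓ x
  ⇓negate : ∀ {e x y} → e ⇓ x → y ≈ - x → negate e ⇓ y
  ⇓binary : ∀ {op e₁ e₂ x y z} → e₁ ⇓ x → e₂ ⇓ y → OpGraph op x y z →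
            binary op e₁ e₂ ⇓ z

IsRepresentation : ∀ {b} → List⁺ (Digit b) → ℕ → Set
IsRepresentation s n = (toℕ (head s) ≢ 0) × (value s ≡ n)

NiceFriedman : ℕ → ℕ → Set
NiceFriedman b n =
  Σ (List⁺ (Digit b)) λ s → IsRepresentation s n ×
  Σ (Expr b) λ e → (digits e ≡ s) × UsesBinary e × (e ⇓ fromℕ n)

-- Count P n c : exactly c of the integers 1, …, n satisfy P.  A relation
-- rather than a function, since P need not be decidable; count-exists and
-- count-unique say that it determines c.
data Count (P : ℕ → Set) : ℕ → ℕ → Set where
  none : Count P 0 0
  hit  : ∀ {n c} → P (suc n) → Count P n c → Count P (suc n) (suc c)
  miss : ∀ {n c} → ¬ P (suc n) → Count P n c → Count P (suc n) c

count-unique : ∀ {P n c d} → Count P n c → Count P n d → c ≡ d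
count-unique none        none         = refl
count-unique (hit _ p)   (hit _ q)    = cong suc (count-unique p q)
count-unique (hit h _)   (miss ¬h _)  = ⊥-elim (¬h h)
count-unique (miss ¬h _) (hit h _)    = ⊥-elim (¬h h)
count-unique (miss _ p)  (miss _ q)   = count-unique p q

count-exists : ∀ P n → ¬ ¬ (∃[ c ] Count P n c)
count-exists P zero    k = k (0 , none)
count-exists P (suc n) k = count-exists P n λ (c , p) →
  k (c , miss (λ h → k (suc c , hit h p)) p)

{-# OPTIONS --safe #-}
module Submission where

-- Write d = b - 1 and Q = b ^ m.  If the base-Q digit of n at position x is Q - 1, that is,
-- n = (P Q + (Q - 1)) Q ^ x + S with S < Q ^ x, then the base-b digits of n are those of P, then m
-- copies of d, then the m x digits of S, and n = ((P + 1) Q - 1) Q ^ x + S.  So n is nice as soon as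
-- the m copies of d suffice to write 1, Q, 1, Q, x in this order.  Choosing m = b ^ r - 1, which is
-- the block of r digits d, the first four numbers cost only O(log m) digits.
--
-- The proportion of numbers that avoid the digit Q - 1 at each of M Q given positions is at most
-- (1 - 1/Q) ^ (M Q), which is small for large M.  It remains to see that the number of distinct x
-- that can be written with k copies of d grows exponentially faster than b ^ k.  They are obtained
-- by iterating moves x ↦ g ^ x + c, where the g are divisible by a fixed prime p exactly once and the
-- c are small: reducing modulo a power of p recovers c, the p-adic valuation recovers x, and then g is
-- known, so different sequences of moves give different numbers.  If the move costs e copies of d, the
-- growth rate exceeds b when the sum of b ^ (- e) over all moves exceeds 1, and for b = 2, 3, 4 this
-- can be achieved with an explicit list of moves.

open import Data.Bool.Base using (Bool; true; false; not; _∧_; T)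
import Data.Bool.Properties as Bool
open import Data.Digit using (Digit; fromDigits)
open import Data.Empty using (⊥; ⊥-elim)
open import Data.Fin using (#_)
open import Data.Fin.Base using (toℕ; fromℕ<)
open import Data.Fin.Properties using (toℕ-fromℕ<)
import Data.Integer.Base as ℤ
import Data.Integer.Properties as ℤₚ
open import Data.List.Base using (List; []; _∷_; [_]; _++_; map; concatMap; length; replicate; reverse)
open import Data.List.Extrema.Nat using (max; xs≤max)
open import Data.List.Membership.Propositional using (_∈_)
open import Data.List.NonEmpty.Base using (List⁺; _∷_; head; toList)
open import Data.List.NonEmpty.Properties using (toList-⁺++⁺)
open import Data.List.Properties using (++-assoc; length-++; length-map; length-replicate; length-reverse; reverse-++)
open import Data.List.Relation.Unary.All as All using (All; []; _∷_)
import Data.List.Relation.Unary.All.Properties as Allₚ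
open import Data.List.Relation.Unary.AllPairs as AllPairs using (AllPairs; []; _∷_)
import Data.List.Relation.Unary.AllPairs.Properties as AllPairsₚ
open import Data.List.Relation.Unary.Any using (here; there)
open import Data.List.Relation.Unary.Unique.Propositional using (Unique)
open import Data.Nat.Base
open import Data.Nat.Divisibility using (_∤_; _∣?_; divides; ∣1⇒≡1; n∣m*n)
open import Data.Nat.DivMod using (_/_; _%_; m≡m%n+[m/n]*n; m%n<n; m%n≤n; m<n*o⇒m/o<n; m/n<m; m≥n⇒m/n>0; m/n*n≤m; m*n/n≡m; m<n⇒m/n≡0; m<n⇒m%n≡m; /-monoˡ-≤; +-distrib-/-∣ʳ; [m+kn]%n≡m%n)
open import Data.Nat.Induction using (<-rec)
open import Data.Nat.ListAction using (sum)
open import Data.Nat.Primality using (Prime; prime?; euclidsLemma; prime⇒nonZero; ¬prime[1])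
open import Data.Nat.Properties
open import Data.List.Membership.DecPropositional _≟_ using (_∈?_)
open import Data.Nat.Tactic.RingSolver using (solve-∀)
open import Data.Product.Base using (∃-syntax; _×_; _,_; proj₁; proj₂)
open import Data.Rational.Base as ℚ using (ℚ; mkℚ; 0ℚ; 1ℚ)
import Data.Rational.Properties as ℚₚ
open import Data.Rational.Solver using (module +-*-Solver)
open import Data.Rational.Unnormalised.Base as ℚᵘ using (mkℚᵘ; *≡*; *<*)
import Data.Rational.Unnormalised.Properties as ℚᵘₚ
open import Data.Sum.Base using (_⊎_; inj₁; inj₂; [_,_]′)
open import Data.Unit.Base using (tt)
open import Defs as R using (seq; fromℕ; fromℤ; 0ℝ; Expr; block; binary; digits; Op; add; sub; mul; div; pow; OpGraph; UsesBinary; _⇓_; ⇓block; ⇓binary; NiceFriedman; Count)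
open import Relation.Binary.Definitions using (tri<; tri≈; tri>)
open import Relation.Binary.PropositionalEquality hiding ([_])
open import Relation.Nullary using (¬_; Dec; yes; no; does; ¬?; _×-dec_)
open import Relation.Nullary.Decidable using (dec-true; dec-false; from-yes)

-- Arithmetic of natural numbers inside the reals.

/-+ : ∀ k l n .{{_ : NonZero n}} → (ℤ.+ k) ℚ./ n ℚ.+ (ℤ.+ l) ℚ./ n ≡ (ℤ.+ (k + l)) ℚ./ n
/-+ k l n@(suc n-1) = ℚₚ.toℚᵘ-injective (begin
  ℚ.toℚᵘ ((ℤ.+ k) ℚ./ n ℚ.+ (ℤ.+ l) ℚ./ n)                  ≈⟨ ℚₚ.toℚᵘ-homo-+ ((ℤ.+ k) ℚ./ n) ((ℤ.+ l) ℚ./ n) ⟩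
  ℚ.toℚᵘ ((ℤ.+ k) ℚ./ n) ℚᵘ.+ ℚ.toℚᵘ ((ℤ.+ l) ℚ./ n)        ≈⟨ ℚᵘₚ.+-cong (ℚₚ.toℚᵘ-fromℚᵘ (mkℚᵘ (ℤ.+ k) n-1)) (ℚₚ.toℚᵘ-fromℚᵘ (mkℚᵘ (ℤ.+ l) n-1)) ⟩
  mkℚᵘ (ℤ.+ k) n-1 ℚᵘ.+ mkℚᵘ (ℤ.+ l) n-1                    ≈⟨ *≡* common ⟩
  mkℚᵘ (ℤ.+ (k + l)) n-1                                    ≈⟨ ℚₚ.toℚᵘ-fromℚᵘ (mkℚᵘ (ℤ.+ (k + l)) n-1) ⟨
  ℚ.toℚᵘ ((ℤ.+ (k + l)) ℚ./ n)                              ∎)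
  where
  open ℚᵘₚ.≃-Reasoning
  common : (ℤ.+ k ℤ.* ℤ.+ n ℤ.+ ℤ.+ l ℤ.* ℤ.+ n) ℤ.* ℤ.+ n ≡ ℤ.+ (k + l) ℤ.* ℤ.+ (n * n)
  common = trans (cong (ℤ._* ℤ.+ n) (sym (ℤₚ.*-distribʳ-+ (ℤ.+ n) (ℤ.+ k) (ℤ.+ l))))
                 (trans (ℤₚ.*-assoc (ℤ.+ k ℤ.+ ℤ.+ l) (ℤ.+ n) (ℤ.+ n)) (cong (ℤ.+ (k + l) ℤ.*_) (sym (ℤₚ.pos-* n n))))

ι : ℕ → ℚ
ι n = ℤ.+ n ℚ./ 1

ι-+ : ∀ m n → ι m ℚ.+ ι n ≡ ι (m + n)
ι-+ m n = /-+ m n 1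

ι-* : ∀ m n → ι m ℚ.* ι n ≡ ι (m * n)
ι-* m n = ℚₚ.toℚᵘ-injective (begin
  ℚ.toℚᵘ (ι m ℚ.* ι n)                ≈⟨ ℚₚ.toℚᵘ-homo-* (ι m) (ι n) ⟩
  ℚ.toℚᵘ (ι m) ℚᵘ.* ℚ.toℚᵘ (ι n)      ≈⟨ ℚᵘₚ.*-cong (ℚₚ.toℚᵘ-fromℚᵘ (mkℚᵘ (ℤ.+ m) 0)) (ℚₚ.toℚᵘ-fromℚᵘ (mkℚᵘ (ℤ.+ n) 0)) ⟩
  mkℚᵘ (ℤ.+ m) 0 ℚᵘ.* mkℚᵘ (ℤ.+ n) 0  ≈⟨ *≡* (cong (ℤ._* ℤ.+ 1) (sym (ℤₚ.pos-* m n))) ⟩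
  mkℚᵘ (ℤ.+ (m * n)) 0                ≈⟨ ℚₚ.toℚᵘ-fromℚᵘ (mkℚᵘ (ℤ.+ (m * n)) 0) ⟨
  ℚ.toℚᵘ (ι (m * n))                  ∎)
  where open ℚᵘₚ.≃-Reasoning

ι-∸ : ∀ {m n} → n ≤ m → ι m ℚ.- ι n ≡ ι (m ∸ n)
ι-∸ {m} {n} n≤m = begin
  ι m ℚ.- ι n                    ≡⟨ cong (λ k → ι k ℚ.- ι n) (m∸n+n≡m n≤m) ⟨
  ι (m ∸ n + n) ℚ.- ι n          ≡⟨ cong (ℚ._- ι n) (ι-+ (m ∸ n) n) ⟨
  ι (m ∸ n) ℚ.+ ι n ℚ.- ι n      ≡⟨ ℚₚ.+-assoc (ι (m ∸ n)) (ι n) (ℚ.- ι n) ⟩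
  ι (m ∸ n) ℚ.+ (ι n ℚ.- ι n)    ≡⟨ cong (ι (m ∸ n) ℚ.+_) (ℚₚ.+-inverseʳ (ι n)) ⟩
  ι (m ∸ n) ℚ.+ 0ℚ               ≡⟨ ℚₚ.+-identityʳ (ι (m ∸ n)) ⟩
  ι (m ∸ n)                      ∎
  where open ≡-Reasoning

-- The reals met below are built from constant sequences, so every real equation that arises reduces
-- to an identity between rationals.
pointwise⇒≈ : ∀ x y → (∀ n → seq x n ≡ seq y n) → x R.≈ y
pointwise⇒≈ x y x≗y ε 0<ε = 0 , λ n _ →
  subst (ℚ._< ε) (sym (cong ℚ.∣_∣ (trans (cong (ℚ._- seq y n) (x≗y n)) (ℚₚ.+-inverseʳ (seq y n))))) 0<ε

fromℕ-nonzero : ∀ n .{{_ : NonZero n}} → fromℕ n R.≉ 0ℝ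
fromℕ-nonzero (suc n) n≈0 with n≈0 1ℚ (ℚₚ.positive⁻¹ 1ℚ)
... | N , close = ℚₚ.<-irrefl refl (begin-strict
  1ℚ                               ≤⟨ ℚₚ.+-monoʳ-≤ 1ℚ (ℚₚ.nonNegative⁻¹ (ι n)) ⟩
  1ℚ ℚ.+ ι n                       ≡⟨ ι-+ 1 n ⟩
  ι (suc n)                        ≡⟨ ℚₚ.0≤p⇒∣p∣≡p (ℚₚ.nonNegative⁻¹ (ι (suc n)) {{ℚₚ.normalize-nonNeg (suc n) 1}}) ⟨
  ℚ.∣ ι (suc n) ∣                  ≡⟨ cong ℚ.∣_∣ (ℚₚ.+-identityʳ (ι (suc n))) ⟨
  ℚ.∣ ι (suc n) ℚ.- 0ℚ ∣           <⟨ close N ≤-refl ⟩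
  1ℚ                               ∎)
  where
  open ℚₚ.≤-Reasoning
  instance
    ι-nonNeg : ℚ.NonNegative (ι n)
    ι-nonNeg = ℚₚ.normalize-nonNeg n 1

seq-^ : ∀ m k n → seq (fromℕ m R.^ k) n ≡ ι (m ^ k)
seq-^ m zero    n = refl
seq-^ m (suc k) n = trans (cong (ι m ℚ.*_) (seq-^ m k n)) (ι-* m (m ^ k))

-- `OpGraph` computes on `op`, which would hide the three numbers from unification; the record keeps
-- them inferable.
record OnNaturals (op : Op) (x y z : ℕ) : Set where
  constructor onNaturals
  field graph : OpGraph op (fromℕ x) (fromℕ y) (fromℕ z)

graph-add : ∀ x y → OnNaturals add x y (x + y)
graph-add x y = onNaturals (pointwise⇒≈ (fromℕ (x + y)) (fromℕ x R.+ fromℕ y) λ _ → sym (ι-+ x y))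

graph-sub : ∀ {x y} → y ≤ x → OnNaturals sub x y (x ∸ y)
graph-sub {x} {y} y≤x = onNaturals (pointwise⇒≈ (fromℕ (x ∸ y)) (fromℕ x R.- fromℕ y) λ _ → sym (ι-∸ y≤x))

graph-mul : ∀ x y → OnNaturals mul x y (x * y)
graph-mul x y = onNaturals (pointwise⇒≈ (fromℕ (x * y)) (fromℕ x R.* fromℕ y) λ _ → sym (ι-* x y))

graph-div : ∀ x y .{{_ : NonZero y}} → OnNaturals div (x * y) y x
graph-div x y = onNaturals (fromℕ-nonzero y , pointwise⇒≈ (fromℕ x R.* fromℕ y) (fromℕ (x * y)) λ _ → ι-* x y)

graph-pow : ∀ x y .{{_ : NonZero x}} → OnNaturals pow x y (x ^ y)
graph-pow x y = onNaturals (R.integerExponent (ℤ.+ y) (fromℕ-nonzero x) (pointwise⇒≈ (fromℕ y) (fromℤ (ℤ.+ y)) λ _ → refl)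
                  (pointwise⇒≈ (fromℕ (x ^ y)) (fromℕ x R.^ y) λ n → sym (seq-^ x y n)))

-- Digit strings, their values and the expressions that spell them.

module _ {b : ℕ} where

  val : List (Digit b) → ℕ
  val ds = fromDigits (reverse ds)

  fromDigits-++ : ∀ (xs ys : List (Digit b)) →
                  fromDigits (xs ++ ys) ≡ fromDigits xs + fromDigits ys * b ^ length xs
  fromDigits-++ []       ys = sym (*-identityʳ (fromDigits ys))
  fromDigits-++ (x ∷ xs) ys =
    trans (cong (λ v → toℕ x + v * b) (fromDigits-++ xs ys))
          (rearrange (toℕ x) (fromDigits xs) (fromDigits ys) (b ^ length xs) b)
    where
    rearrange : ∀ t u v w b → t + (u + v * w) * b ≡ t + u * b + v * (b * w)
    rearrange = solve-∀

  val-++ : ∀ xs ys → val (xs ++ ys) ≡ val xs * b ^ length ys + val ys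
  val-++ xs ys = begin
    fromDigits (reverse (xs ++ ys))                ≡⟨ cong fromDigits (reverse-++ xs ys) ⟩
    fromDigits (reverse ys ++ reverse xs)          ≡⟨ fromDigits-++ (reverse ys) (reverse xs) ⟩
    val ys + val xs * b ^ length (reverse ys)      ≡⟨ cong (λ l → val ys + val xs * b ^ l) (length-reverse ys) ⟩
    val ys + val xs * b ^ length ys                ≡⟨ +-comm (val ys) _ ⟩
    val xs * b ^ length ys + val ys                ∎
    where open ≡-Reasoning

  val-∷ʳ : ∀ xs x → val (xs ++ [ x ]) ≡ val xs * b + toℕ x
  val-∷ʳ xs x = trans (val-++ xs [ x ])
                      (cong₂ (λ u v → val xs * u + v) (*-identityʳ b) (+-identityʳ (toℕ x)))

  -- Serves twice: it evaluates the window of `m` top digits, and it makes a block of `r` top digits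
  -- stand for `b ^ r - 1`, the cheap source of the huge exponent `m`.
  val-replicate-max : ∀ (d : Digit b) → suc (toℕ d) ≡ b → ∀ n → suc (val (replicate n d)) ≡ b ^ n
  val-replicate-max d d+1≡b zero    = refl
  val-replicate-max d d+1≡b (suc n) = begin
    suc (val ([ d ] ++ replicate n d))                                       ≡⟨ cong suc (val-++ [ d ] (replicate n d)) ⟩
    suc (val [ d ] * b ^ length (replicate n d) + val (replicate n d))       ≡⟨ +-suc _ _ ⟨
    val [ d ] * b ^ length (replicate n d) + suc (val (replicate n d))       ≡⟨ cong₂ (λ l v → val [ d ] * b ^ l + v) (length-replicate n) (val-replicate-max d d+1≡b n) ⟩
    (toℕ d + 0) * b ^ n + b ^ n                                              ≡⟨ cong (λ t → t * b ^ n + b ^ n) (+-identityʳ (toℕ d)) ⟩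
    toℕ d * b ^ n + b ^ n                                                    ≡⟨ +-comm _ (b ^ n) ⟩
    suc (toℕ d) * b ^ n                                                      ≡⟨ cong (_* b ^ n) d+1≡b ⟩
    b ^ suc n                                                                ∎
    where open ≡-Reasoning

  -- Leading zeros are wanted here: `S` must fill all the `m * x` places below the window.
  digits-of-length : .{{_ : NonZero b}} → ∀ k S → S < b ^ k → ∃[ ds ] length ds ≡ k × val ds ≡ S
  digits-of-length zero    zero    _     = [] , refl , refl
  digits-of-length zero    (suc _) (s≤s ())
  digits-of-length (suc k) S       S<b^k
    with digits-of-length k (S / b) (m<n*o⇒m/o<n (subst (S <_) (*-comm b (b ^ k)) S<b^k))
  ... | ds , len , eq = ds ++ [ x ] , trans (length-++ ds) (trans (+-comm (length ds) 1) (cong suc len)) ,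
        (begin
          val (ds ++ [ x ])      ≡⟨ val-∷ʳ ds x ⟩
          val ds * b + toℕ x     ≡⟨ cong₂ (λ v t → v * b + t) eq (toℕ-fromℕ< (m%n<n S b)) ⟩
          S / b * b + S % b      ≡⟨ +-comm (S / b * b) (S % b) ⟩
          S % b + S / b * b      ≡⟨ m≡m%n+[m/n]*n S b ⟨
          S                      ∎)
    where
    open ≡-Reasoning
    x : Digit b
    x = fromℕ< (m%n<n S b)

  LeadingNonzero : List (Digit b) → Set
  LeadingNonzero []      = ⊥
  LeadingNonzero (d ∷ _) = toℕ d ≢ 0

  leading-++ : ∀ {ds} es → LeadingNonzero ds → LeadingNonzero (ds ++ es)
  leading-++ {_ ∷ _} es d≢0 = d≢0

  representation : 1 < b → ∀ P → 0 < P → ∃[ ds ] LeadingNonzero ds × val ds ≡ P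
  representation 1<b = <-rec _ go
    where
    instance
      b≢0 : NonZero b
      b≢0 = >-nonZero (<-trans z<s 1<b)
    go : ∀ P → (∀ {k} → k < P → 0 < k → ∃[ ds ] LeadingNonzero ds × val ds ≡ k) →
         0 < P → ∃[ ds ] LeadingNonzero ds × val ds ≡ P
    go P rec 0<P with P <? b
    ... | yes P<b = [ fromℕ< P<b ] , (λ eq → <-irrefl (sym (trans (sym (toℕ-fromℕ< P<b)) eq)) 0<P) ,
                    trans (+-identityʳ _) (toℕ-fromℕ< P<b)
    ... | no  P≮b with rec {P / b} (m/n<m P b {{>-nonZero 0<P}} 1<b) (m≥n⇒m/n>0 (≮⇒≥ P≮b))
    ...   | ds , lead , eq = ds ++ [ x ] , leading-++ [ x ] lead ,
            (begin
              val (ds ++ [ x ])      ≡⟨ val-∷ʳ ds x ⟩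
              val ds * b + toℕ x     ≡⟨ cong₂ (λ v t → v * b + t) eq (toℕ-fromℕ< (m%n<n P b)) ⟩
              P / b * b + P % b      ≡⟨ +-comm (P / b * b) (P % b) ⟩
              P % b + P / b * b      ≡⟨ m≡m%n+[m/n]*n P b ⟨
              P                      ∎)
      where
      open ≡-Reasoning
      x : Digit b
      x = fromℕ< (m%n<n P b)

  -- Digits are compared as plain lists, so that regrouping segments is just associativity of
  -- `_++_`.
  record Writes (ds : List (Digit b)) (x : ℕ) : Set where
    constructor writes
    field
      expr       : Expr b
      digits≡    : toList (digits expr) ≡ ds
      evaluates  : expr ⇓ fromℕ x

  writes-block : ∀ d ds → Writes (d ∷ ds) (val (d ∷ ds))
  writes-block d ds = writes (block (d ∷ ds)) refl
    (⇓block (pointwise⇒≈ (fromℕ (val (d ∷ ds))) (fromℕ (val (d ∷ ds))) λ _ → refl))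

  writes-binary : ∀ op {ds es x y z} → OnNaturals op x y z → Writes ds x → Writes es y → Writes (ds ++ es) z
  writes-binary op (onNaturals graph) (writes e refl ⇓x) (writes f refl ⇓y) =
    writes (binary op e f) (sym (toList-⁺++⁺ (digits e) (digits f))) (⇓binary ⇓x ⇓y graph)

replicate-+ : ∀ {A : Set} m n (a : A) → replicate (m + n) a ≡ replicate m a ++ replicate n a
replicate-+ zero    n a = refl
replicate-+ (suc m) n a = cong (a ∷_) (replicate-+ m n a)

nice : ∀ {b} {s : List (Digit b)} {n} → LeadingNonzero s → val s ≡ n →
       ∀ e → toList (digits e) ≡ s → UsesBinary e → e ⇓ fromℕ n → NiceFriedman b n
nice lead val≡n e refl uses ⇓n =
  digits e , (head≢0 (digits e) lead , val≡n) , e , refl , uses , ⇓n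
  where
  head≢0 : ∀ (ds : List⁺ _) → LeadingNonzero (toList ds) → toℕ (head ds) ≢ 0
  head≢0 (_ ∷ _) d≢0 = d≢0

-- Numbers written with copies of a single digit.

module Copying {b : ℕ} (d : Digit b) where

  -- Since all the digits are equal, only their number matters, and it adds up under each operation.
  -- This number is the cost of `x`.
  Copies : ℕ → ℕ → Set
  Copies n x = Writes (replicate n d) x

  copies-binary : ∀ op {m n x y z} → OnNaturals op x y z → Copies m x → Copies n y → Copies (m + n) z
  copies-binary op {m} {n} graph X Y =
    subst (λ ds → Writes ds _) (sym (replicate-+ m n d)) (writes-binary op graph X Y)

  infixl 6 _⊕_
  infixl 7 _⊗_
  infixr 8 _↑_

  _⊕_ : ∀ {m n x y} → Copies m x → Copies n y → Copies (m + n) (x + y)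
  _⊕_ {x = x} {y} = copies-binary add (graph-add x y)

  difference : ∀ {m n x y} → y ≤ x → Copies m x → Copies n y → Copies (m + n) (x ∸ y)
  difference y≤x = copies-binary sub (graph-sub y≤x)

  _⊗_ : ∀ {m n x y} → Copies m x → Copies n y → Copies (m + n) (x * y)
  _⊗_ {x = x} {y} = copies-binary mul (graph-mul x y)

  _↑_ : ∀ {m n x y} .{{_ : NonZero x}} → Copies m x → Copies n y → Copies (m + n) (x ^ y)
  _↑_ {x = x} {y} = copies-binary pow (graph-pow x y)

  quotient : ∀ {m n} x {y} .{{_ : NonZero y}} → Copies m (x * y) → Copies n y → Copies (m + n) x
  quotient x {y} = copies-binary div (graph-div x y)

  copies-block : ∀ r → Copies (suc r) (val (replicate (suc r) d))
  copies-block r = writes-block d (replicate r d)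

  copies-sum : ∀ n → Copies (suc n) (suc n * toℕ d)
  copies-sum zero    = subst (Copies 1) refl (copies-block 0)
  copies-sum (suc n) = subst (λ x → Copies (2 + n) (x + suc n * toℕ d)) (+-identityʳ (toℕ d)) (copies-block 0 ⊕ copies-sum n)

  module _ (1<b : 1 < b) (d+1≡b : suc (toℕ d) ≡ b) where

    -- The window is cut into segments of `ω`, `ζ`, `ω`, `ζ` and `c` copies, which write 1, Q, 1, Q
    -- and `x` in `((P + 1) * Q - 1) * Q ^ x + S`; `P` and `S` are blocks. Positivity of `P` and of
    -- `m * x` makes both blocks nonempty.
    nice-of-window : ∀ {m q ω ζ c x} → suc q ≡ b ^ m → ω + (ζ + (ω + (ζ + c))) ≡ m →
      Copies ω 1 → Copies ζ (suc q) → Copies c x →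
      ∀ P S → 0 < P → 0 < m * x → S < suc q ^ x →
      NiceFriedman b ((P * suc q + q) * suc q ^ x + S)
    nice-of-window {m} {q} {ω} {ζ} {c} {x} Q≡ m≡ one Q X P S 0<P 0<mx S<
      with representation 1<b P 0<P
         | digits-of-length {b} {{>-nonZero (<-trans z<s 1<b)}} (m * x) S
             (subst (S <_) (trans (cong (_^ x) Q≡) (^-*-assoc b m x)) S<)
    ... | []     , ()   , _    | _
    ... | p ∷ ps , lead , refl | []     , len , refl = ⊥-elim (<-irrefl len 0<mx)
    ... | p ∷ ps , lead , refl | s ∷ ss , len , refl =
      nice lead val≡ calculation digits≡ _
        (subst (λ n → calculation ⇓ fromℕ n) value≡ 
          (⇓binary {op = add} (evaluates body) (evaluates tail) (OnNaturals.graph (graph-add (((P + 1) * suc q ∸ 1) * suc q ^ x) S))))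
      where
      open Writes using (expr; evaluates)

      R : ℕ → List (Digit b)
      R k = replicate k d

      1≤ : 1 ≤ (P + 1) * suc q
      1≤ = *-mono-≤ (m≤n+m 1 P) (s≤s z≤n)

      prefix : Writes (((((p ∷ ps) ++ R ω) ++ R ζ) ++ R ω)) ((P + 1) * suc q ∸ 1)
      prefix = writes-binary sub (graph-sub 1≤)
        (writes-binary mul (graph-mul (P + 1) (suc q))
          (writes-binary add (graph-add P 1) (writes-block p ps) one) Q) one

      body : Writes (((((p ∷ ps) ++ R ω) ++ R ζ) ++ R ω) ++ R (ζ + c)) (((P + 1) * suc q ∸ 1) * suc q ^ x)
      body = writes-binary mul (graph-mul ((P + 1) * suc q ∸ 1) (suc q ^ x)) prefix (Q ↑ X)

      tail : Writes (s ∷ ss) S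
      tail = writes-block s ss

      calculation : Expr b
      calculation = binary add (expr body) (expr tail)

      regroup : ((((p ∷ ps) ++ R ω) ++ R ζ) ++ R ω) ++ R (ζ + c) ≡ (p ∷ ps) ++ R m
      regroup = begin
        ((((p ∷ ps) ++ R ω) ++ R ζ) ++ R ω) ++ R (ζ + c)       ≡⟨ ++-assoc (((p ∷ ps) ++ R ω) ++ R ζ) (R ω) _ ⟩
        (((p ∷ ps) ++ R ω) ++ R ζ) ++ R ω ++ R (ζ + c)         ≡⟨ ++-assoc ((p ∷ ps) ++ R ω) (R ζ) _ ⟩
        ((p ∷ ps) ++ R ω) ++ R ζ ++ R ω ++ R (ζ + c)           ≡⟨ ++-assoc (p ∷ ps) (R ω) _ ⟩
        (p ∷ ps) ++ R ω ++ R ζ ++ R ω ++ R (ζ + c)             ≡⟨ cong (λ l → (p ∷ ps) ++ R ω ++ R ζ ++ l) (replicate-+ ω (ζ + c) d) ⟨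
        (p ∷ ps) ++ R ω ++ R ζ ++ R (ω + (ζ + c))              ≡⟨ cong (λ l → (p ∷ ps) ++ R ω ++ l) (replicate-+ ζ (ω + (ζ + c)) d) ⟨
        (p ∷ ps) ++ R ω ++ R (ζ + (ω + (ζ + c)))               ≡⟨ cong ((p ∷ ps) ++_) (replicate-+ ω (ζ + (ω + (ζ + c))) d) ⟨
        (p ∷ ps) ++ R (ω + (ζ + (ω + (ζ + c))))                ≡⟨ cong (λ k → (p ∷ ps) ++ R k) m≡ ⟩
        (p ∷ ps) ++ R m                                        ∎
        where open ≡-Reasoning

      digits≡ : toList (digits calculation) ≡ ((p ∷ ps) ++ R m) ++ (s ∷ ss)
      digits≡ = trans (sym (toList-⁺++⁺ (digits (expr body)) (s ∷ ss)))
                      (cong (_++ (s ∷ ss)) (trans (Writes.digits≡ body) regroup))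

      value≡ : ((P + 1) * suc q ∸ 1) * suc q ^ x + S ≡ (P * suc q + q) * suc q ^ x + S
      value≡ = cong (λ v → v * suc q ^ x + S)
        (cong (_∸ 1) (trans (*-distribʳ-+ (suc q) P 1)
          (trans (cong (P * suc q +_) (*-identityˡ (suc q))) (+-suc (P * suc q) q))))

      val≡ : val (((p ∷ ps) ++ R m) ++ (s ∷ ss)) ≡ (P * suc q + q) * suc q ^ x + S
      val≡ = begin
        val (((p ∷ ps) ++ R m) ++ (s ∷ ss))                           ≡⟨ val-++ ((p ∷ ps) ++ R m) (s ∷ ss) ⟩
        val ((p ∷ ps) ++ R m) * b ^ length (s ∷ ss) + S               ≡⟨ cong₂ (λ v l → v * b ^ l + S) (val-++ (p ∷ ps) (R m)) len ⟩
        (P * b ^ length (R m) + val (R m)) * b ^ (m * x) + S          ≡⟨ cong (λ l → (P * b ^ l + val (R m)) * b ^ (m * x) + S) (length-replicate m) ⟩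
        (P * b ^ m + val (R m)) * b ^ (m * x) + S                     ≡⟨ cong (λ v → (P * b ^ m + v) * b ^ (m * x) + S) (suc-injective (trans (val-replicate-max d d+1≡b m) (sym Q≡))) ⟩
        (P * b ^ m + q) * b ^ (m * x) + S                             ≡⟨ cong (λ v → (P * b ^ m + q) * v + S) (^-*-assoc b m x) ⟨
        (P * b ^ m + q) * (b ^ m) ^ x + S                             ≡⟨ cong (λ v → (P * v + q) * v ^ x + S) Q≡ ⟨
        (P * suc q + q) * suc q ^ x + S                               ∎
        where open ≡-Reasoning

-- Counting with Boolean predicates.

indicator : Bool → ℕ
indicator true  = 1
indicator false = 0

cnt : (ℕ → Bool) → ℕ → ℕ
cnt f zero    = 0
cnt f (suc n) = indicator (f n) + cnt f n

_⊑_ : (ℕ → Bool) → (ℕ → Bool) → Set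
f ⊑ g = ∀ v → f v ≡ true → g v ≡ true

indicator-mono : ∀ {x y} → (x ≡ true → y ≡ true) → indicator x ≤ indicator y
indicator-mono {true}  h rewrite h refl = ≤-refl
indicator-mono {false} h = z≤n

cnt-mono : ∀ {f g} → f ⊑ g → ∀ n → cnt f n ≤ cnt g n
cnt-mono f⊑g zero    = z≤n
cnt-mono f⊑g (suc n) = +-mono-≤ (indicator-mono (f⊑g n)) (cnt-mono f⊑g n)

cnt-cong : ∀ {f g} n → (∀ v → v < n → f v ≡ g v) → cnt f n ≡ cnt g n
cnt-cong zero    f≗g = refl
cnt-cong (suc n) f≗g = cong₂ (λ x y → indicator x + y) (f≗g n ≤-refl) (cnt-cong n λ v v<n → f≗g v (m<n⇒m<1+n v<n))

cnt-false : ∀ n → cnt (λ _ → false) n ≡ 0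
cnt-false zero    = refl
cnt-false (suc n) = cnt-false n

cnt-+ : ∀ f m n → cnt f (m + n) ≡ cnt (λ v → f (v + n)) m + cnt f n
cnt-+ f zero    n = refl
cnt-+ f (suc m) n = trans (cong (indicator (f (m + n)) +_) (cnt-+ f m n)) (sym (+-assoc (indicator (f (m + n))) _ _))

cnt-monoʳ : ∀ f {m n} → m ≤ n → cnt f m ≤ cnt f n
cnt-monoʳ f {m} {n} m≤n = subst (λ k → cnt f m ≤ cnt f k) (m∸n+n≡m m≤n)
  (subst (cnt f m ≤_) (sym (cnt-+ f (n ∸ m) m)) (m≤n+m (cnt f m) _))

cnt-periodic : ∀ {f} R → (∀ v k → f (v + k * R) ≡ f v) → ∀ a → cnt f (a * R) ≡ a * cnt f R
cnt-periodic     R per zero    = refl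
cnt-periodic {f} R per (suc a) = trans (cnt-+ f R (a * R))
  (cong₂ _+_ (cnt-cong R λ v _ → per v a) (cnt-periodic R per a))

cnt-strict : ∀ {f g} → f ⊑ g → ∀ {x n} → f x ≡ false → g x ≡ true → x < n → suc (cnt f n) ≤ cnt g n
cnt-strict {f} {g} f⊑g {x} {suc n} fx gx x<1+n with x ≟ n
... | yes refl rewrite fx | gx = s≤s (cnt-mono f⊑g n)
... | no  x≢n  = subst (_≤ cnt g (suc n)) (+-suc (indicator (f n)) (cnt f n))
      (+-mono-≤ (indicator-mono (f⊑g n)) (cnt-strict f⊑g fx gx (≤∧≢⇒< (≤-pred x<1+n) x≢n)))

does⇒ : ∀ {A : Set} (A? : Dec A) → does A? ≡ true → A
does⇒ (yes a) _ = a

-- Each fresh element makes the membership predicate true at one more point below `L`.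
length≤cnt : ∀ {L xs} → Unique xs → All (_< L) xs → length xs ≤ cnt (λ i → does (i ∈? xs)) L
length≤cnt []           []            = z≤n
length≤cnt {L} {x ∷ xs} (x∉ ∷ uniq) (x<L ∷ xs<L) =
  ≤-trans (s≤s (length≤cnt uniq xs<L))
    (cnt-strict {λ i → does (i ∈? xs)} {λ i → does (i ∈? (x ∷ xs))} grow {x} {L}
      (dec-false (x ∈? xs) (λ x∈ → All.lookup x∉ x∈ refl)) (dec-true (x ∈? (x ∷ xs)) (here refl)) x<L)
  where
  grow : (λ i → does (i ∈? xs)) ⊑ (λ i → does (i ∈? (x ∷ xs)))
  grow i eq = dec-true (i ∈? (x ∷ xs)) (there (does⇒ (i ∈? xs) eq))

∧-not-∧ : ∀ x y z → x ∧ not (y ∧ z) ≡ false → x ≡ false ⊎ (y ≡ true × z ≡ true)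
∧-not-∧ false y    z    _ = inj₁ refl
∧-not-∧ true  true true _ = inj₂ (refl , refl)

-- How many numbers avoid the digit `q` at chosen positions.

module Base (q : ℕ) where

  Q : ℕ
  Q = suc q

  Q^≢0 : ∀ x → NonZero (Q ^ x)
  Q^≢0 x = m^n≢0 Q x

  digitAt : ℕ → ℕ → ℕ
  digitAt x v = (v / Q ^ x) {{Q^≢0 x}} % Q

  digitAt-periodic : ∀ x v k → digitAt x (v + k * Q ^ suc x) ≡ digitAt x v
  digitAt-periodic x v k = begin
    (v + k * Q ^ suc x) / Q ^ x % Q                  ≡⟨ cong (λ t → (v + t) / Q ^ x % Q) (*-assoc k Q (Q ^ x)) ⟨
    (v + k * Q * Q ^ x) / Q ^ x % Q                  ≡⟨ cong (_% Q) (+-distrib-/-∣ʳ v (n∣m*n (k * Q))) ⟩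
    (v / Q ^ x + k * Q * Q ^ x / Q ^ x) % Q          ≡⟨ cong (λ t → (v / Q ^ x + t) % Q) (m*n/n≡m (k * Q) (Q ^ x)) ⟩
    (v / Q ^ x + k * Q) % Q                          ≡⟨ [m+kn]%n≡m%n (v / Q ^ x) k Q ⟩
    v / Q ^ x % Q                                    ∎
    where
    open ≡-Reasoning
    instance
      _ : NonZero (Q ^ x)
      _ = Q^≢0 x

  digitAt-top : ∀ x w → w < Q ^ x → digitAt x (w + q * Q ^ x) ≡ q
  digitAt-top x w w<Q^x = begin
    (w + q * Q ^ x) / Q ^ x % Q              ≡⟨ cong (_% Q) (+-distrib-/-∣ʳ w (n∣m*n q)) ⟩
    (w / Q ^ x + q * Q ^ x / Q ^ x) % Q      ≡⟨ cong₂ (λ s t → (s + t) % Q) (m<n⇒m/n≡0 w<Q^x) (m*n/n≡m q (Q ^ x)) ⟩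
    q % Q                                    ≡⟨ m<n⇒m%n≡m ≤-refl ⟩
    q                                        ∎
    where
    open ≡-Reasoning
    instance
      _ : NonZero (Q ^ x)
      _ = Q^≢0 x

  module _ (χ : ℕ → Bool) where

    -- True of `v` when no position below `j` selected by `χ` carries the base-`Q` digit `q`. Only
    -- the `j` lowest digits of `v` matter, hence the period `Q ^ j`.
    bad : ℕ → ℕ → Bool
    bad zero    v = true
    bad (suc j) v = bad j v ∧ not (χ j ∧ (digitAt j v ≡ᵇ q))

    bad-periodic : ∀ j v k → bad j (v + k * Q ^ j) ≡ bad j v
    bad-periodic zero    v k = refl
    bad-periodic (suc j) v k = cong₂ (λ x t → x ∧ not (χ j ∧ (t ≡ᵇ q)))
      (trans (cong (λ t → bad j (v + t)) (sym (*-assoc k Q (Q ^ j)))) (bad-periodic j v (k * Q)))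
      (digitAt-periodic j v k)

    bad-suc⊑bad : ∀ j → bad (suc j) ⊑ bad j
    bad-suc⊑bad j v = Bool.∧-conicalˡ (bad j v) _

    ¬bad⇒digit : ∀ j v → bad j v ≡ false → ∃[ x ] x < j × χ x ≡ true × digitAt x v ≡ q
    ¬bad⇒digit (suc j) v eq with ∧-not-∧ (bad j v) (χ j) (digitAt j v ≡ᵇ q) eq
    ... | inj₁ ¬bad          = let x , x<j , rest = ¬bad⇒digit j v ¬bad in x , m<n⇒m<1+n x<j , rest
    ... | inj₂ (χj , digit≡) = j , ≤-refl , χj , ≡ᵇ⇒≡ (digitAt j v) q (subst T (sym digit≡) tt)

    bads : ℕ → ℕ
    bads j = cnt (bad j) (Q ^ j)

    cnt-bad : ∀ j a → cnt (bad j) (a * Q ^ j) ≡ a * bads j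
    cnt-bad j = cnt-periodic (Q ^ j) (bad-periodic j)

    bads-suc : ∀ j → bads (suc j) ≤ Q * bads j
    bads-suc j = ≤-trans (cnt-mono (bad-suc⊑bad j) (Q ^ suc j)) (≤-reflexive (cnt-bad j Q))

    -- Of the `Q` intervals of length `Q ^ j` below `Q ^ suc j`, the top one has digit `q` at
    -- position `j` and contributes nothing; each of the other `q` contributes at most `bads j`.
    bads-suc-∈ : ∀ j → χ j ≡ true → bads (suc j) ≤ q * bads j
    bads-suc-∈ j χj = begin
      cnt (bad (suc j)) (Q ^ j + q * Q ^ j)                                                     ≡⟨ cnt-+ (bad (suc j)) (Q ^ j) (q * Q ^ j) ⟩
      cnt (λ w → bad (suc j) (w + q * Q ^ j)) (Q ^ j) + cnt (bad (suc j)) (q * Q ^ j)           ≡⟨ cong (_+ cnt (bad (suc j)) (q * Q ^ j)) (trans (cnt-cong (Q ^ j) top) (cnt-false (Q ^ j))) ⟩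
      cnt (bad (suc j)) (q * Q ^ j)                                                             ≤⟨ cnt-mono (bad-suc⊑bad j) (q * Q ^ j) ⟩
      cnt (bad j) (q * Q ^ j)                                                                   ≡⟨ cnt-bad j q ⟩
      q * bads j                                                                                ∎
      where
      open ≤-Reasoning
      top : ∀ w → w < Q ^ j → bad (suc j) (w + q * Q ^ j) ≡ false
      top w w< rewrite χj | digitAt-top j w w< | dec-true (q ≟ q) refl = Bool.∧-zeroʳ _

    -- Every selected position multiplies the proportion of bad residues by at most q/Q. This is the
    -- resulting bound (q/Q)^c with denominators cleared.
    bads-bound : ∀ j → bads j * Q ^ cnt χ j ≤ q ^ cnt χ j * Q ^ j
    bads-bound zero = ≤-refl
    bads-bound (suc j) = step (χ j) refl
      where
      c : ℕ
      c = cnt χ j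
      step : ∀ y → χ j ≡ y →
             bads (suc j) * Q ^ (indicator y + c) ≤ q ^ (indicator y + c) * Q ^ suc j
      step true  χj = begin
        bads (suc j) * (Q * Q ^ c)     ≤⟨ *-monoˡ-≤ (Q * Q ^ c) (bads-suc-∈ j χj) ⟩
        q * bads j * (Q * Q ^ c)       ≡⟨ regroup q (bads j) Q (Q ^ c) ⟩
        q * Q * (bads j * Q ^ c)       ≤⟨ *-monoʳ-≤ (q * Q) (bads-bound j) ⟩
        q * Q * (q ^ c * Q ^ j)        ≡⟨ regroup q (q ^ c) Q (Q ^ j) ⟨
        q * q ^ c * (Q * Q ^ j)        ∎
        where
        open ≤-Reasoning
        regroup : ∀ s t u v → s * t * (u * v) ≡ s * u * (t * v)
        regroup = solve-∀
      step false _ = begin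
        bads (suc j) * Q ^ c           ≤⟨ *-monoˡ-≤ (Q ^ c) (bads-suc j) ⟩
        Q * bads j * Q ^ c             ≡⟨ *-assoc Q (bads j) (Q ^ c) ⟩
        Q * (bads j * Q ^ c)           ≤⟨ *-monoʳ-≤ Q (bads-bound j) ⟩
        Q * (q ^ c * Q ^ j)            ≡⟨ regroup Q (q ^ c) (Q ^ j) ⟩
        q ^ c * (Q * Q ^ j)            ∎
        where
        open ≤-Reasoning
        regroup : ∀ s t u → s * (t * u) ≡ t * (s * u)
        regroup = solve-∀

-- From many window positions to a density bound.

-- Bernoulli's inequality (1 + 1/q)^n ≥ 1 + n/q, multiplied by q^(n+1).
bernoulli : ∀ q n → (n + q) * q ^ n ≤ q * suc q ^ n
bernoulli q zero    = ≤-refl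
bernoulli q (suc n) = begin
  (suc n + q) * (q * q ^ n)                ≤⟨ m≤m+n _ (n * q ^ n) ⟩
  (suc n + q) * (q * q ^ n) + n * q ^ n    ≡⟨ regroup n q (q ^ n) ⟩
  suc q * ((n + q) * q ^ n)                ≤⟨ *-monoʳ-≤ (suc q) (bernoulli q n) ⟩
  suc q * (q * suc q ^ n)                  ≡⟨ swap (suc q) q (suc q ^ n) ⟩
  q * (suc q * suc q ^ n)                  ∎
  where
  open ≤-Reasoning
  regroup : ∀ n q w → (suc n + q) * (q * w) + n * w ≡ suc q * ((n + q) * w)
  regroup = solve-∀
  swap : ∀ s t u → s * (t * u) ≡ t * (s * u)
  swap = solve-∀

Count-≤ : ∀ {P n F} → Count P n F → F ≤ n
Count-≤ Count.none       = z≤n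
Count-≤ (Count.hit _ c)  = s≤s (Count-≤ c)
Count-≤ (Count.miss _ c) = m≤n⇒m≤1+n (Count-≤ c)

-- Each of 1, ..., n is below `R`, is counted in `F`, or satisfies `f`. The argument of `f` is
-- shifted because `cnt` starts at 0 and `Count` at 1.
Count-lower : ∀ {P} (f : ℕ → Bool) R → (∀ v → R ≤ v → f v ≡ false → P v) →
              ∀ {n F} → Count P n F → n ≤ R + F + cnt (λ v → f (suc v)) n
Count-lower f R good Count.none = z≤n
Count-lower f R good {suc n} {suc F} (Count.hit _ c) = begin
  suc n                                        ≤⟨ s≤s (Count-lower f R good c) ⟩
  suc (R + F) + cnt (λ v → f (suc v)) n        ≡⟨ cong (_+ cnt (λ v → f (suc v)) n) (+-suc R F) ⟨
  R + suc F + cnt (λ v → f (suc v)) n          ≤⟨ +-monoʳ-≤ (R + suc F) (m≤n+m _ _) ⟩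
  R + suc F + cnt (λ v → f (suc v)) (suc n)    ∎
  where open ≤-Reasoning
Count-lower f R good {suc n} {F} (Count.miss ¬p c) with R ≤? suc n
... | no  R≰ = ≤-trans (<⇒≤ (≰⇒> R≰)) (≤-trans (m≤m+n R F) (m≤m+n (R + F) _))
... | yes R≤ with f (suc n) in eq
...   | false = ⊥-elim (¬p (good (suc n) R≤ eq))
...   | true  = ≤-trans (s≤s (Count-lower f R good c)) (≤-reflexive (sym (+-suc (R + F) _)))

-- With `4 * D * q` positions, Bernoulli's inequality brings the proportion of bad residues down to
-- 1/(4D). The factor 4 leaves room for the numbers below `R` and for an incomplete last period.
density : ∀ (P : ℕ → Set) q .{{_ : NonZero q}} D xs → Unique xs → 4 * D * q ≤ length xs →
          (∀ x M S → x ∈ xs → 0 < M → S < suc q ^ x → P ((M * suc q + q) * suc q ^ x + S)) →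
          ∃[ N ] ∀ n → N ≤ n → ∀ F → Count P n F → F ≤ n × (n ∸ F) * D < n
-- The threshold collects the additive constants that arise in `few`.
density P q D xs unique long windows = 2 + (R + 4 * D * R) , λ n N≤n F count → Count-≤ count , few n N≤n F count
  where
  open Base q

  L : ℕ
  L = suc (max 0 xs)

  χ : ℕ → Bool
  χ i = does (i ∈? xs)

  R B c : ℕ
  R = Q ^ L
  B = bads χ L
  c = cnt χ L

  c≥ : 4 * D * q ≤ c
  c≥ = ≤-trans long (length≤cnt unique (All.map s≤s (xs≤max 0 xs)))

  4D*q^c≤Q^c : 4 * D * q ^ c ≤ Q ^ c
  4D*q^c≤Q^c = *-cancelˡ-≤ q (begin
    q * (4 * D * q ^ c)    ≡⟨ swap q (4 * D) (q ^ c) ⟩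
    4 * D * q * q ^ c      ≤⟨ *-monoˡ-≤ (q ^ c) (≤-trans c≥ (m≤m+n c q)) ⟩
    (c + q) * q ^ c        ≤⟨ bernoulli q c ⟩
    q * Q ^ c              ∎)
    where
    open ≤-Reasoning
    swap : ∀ s t u → s * (t * u) ≡ t * s * u
    swap = solve-∀

  4D*B≤R : 4 * D * B ≤ R
  4D*B≤R = *-cancelʳ-≤ (4 * D * B) R (Q ^ c) {{Q^≢0 c}} (begin
    4 * D * B * Q ^ c          ≡⟨ *-assoc (4 * D) B (Q ^ c) ⟩
    4 * D * (B * Q ^ c)        ≤⟨ *-monoʳ-≤ (4 * D) (bads-bound χ L) ⟩
    4 * D * (q ^ c * R)        ≡⟨ *-assoc (4 * D) (q ^ c) R ⟨
    4 * D * q ^ c * R          ≤⟨ *-monoˡ-≤ R 4D*q^c≤Q^c ⟩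
    Q ^ c * R                  ≡⟨ *-comm (Q ^ c) R ⟩
    R * Q ^ c                  ∎)
    where open ≤-Reasoning

  instance
    R≢0 : NonZero R
    R≢0 = Q^≢0 L

  good : ∀ v → R ≤ v → bad χ L v ≡ false → P v
  good v R≤v ¬bad with ¬bad⇒digit χ L v ¬bad
  ... | x , x<L , χx , digit≡ =
    subst P v≡ (windows x top low (does⇒ (x ∈? xs) χx) (m≥n⇒m/n>0 Q≤) (m%n<n v (Q ^ x)))
    where
    instance
      _ : NonZero (Q ^ x)
      _ = Q^≢0 x
    top low : ℕ
    top = v / Q ^ x / Q
    low = v % Q ^ x
    -- Since `x < L` and `Q ^ L ≤ v`, something nonzero remains above position `x`; this is the
    -- positive `P` of the window.
    Q≤ : Q ≤ v / Q ^ x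
    Q≤ = begin
      Q                       ≡⟨ m*n/n≡m Q (Q ^ x) ⟨
      Q * Q ^ x / Q ^ x       ≤⟨ /-monoˡ-≤ (Q ^ x) (≤-trans (^-monoʳ-≤ Q x<L) R≤v) ⟩
      v / Q ^ x               ∎
      where open ≤-Reasoning
    v≡ : (v / Q ^ x / Q * Q + q) * Q ^ x + v % Q ^ x ≡ v
    v≡ = begin
      (v / Q ^ x / Q * Q + q) * Q ^ x + v % Q ^ x              ≡⟨ cong (λ t → (v / Q ^ x / Q * Q + t) * Q ^ x + v % Q ^ x) digit≡ ⟨
      (v / Q ^ x / Q * Q + digitAt x v) * Q ^ x + v % Q ^ x    ≡⟨ cong (λ t → t * Q ^ x + v % Q ^ x) (trans (+-comm _ (digitAt x v)) (sym (m≡m%n+[m/n]*n (v / Q ^ x) Q))) ⟩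
      v / Q ^ x * Q ^ x + v % Q ^ x                            ≡⟨ trans (+-comm _ (v % Q ^ x)) (sym (m≡m%n+[m/n]*n v (Q ^ x))) ⟩
      v                                                        ∎
      where open ≡-Reasoning

  -- `suc n` is rounded up to whole periods; by `4D*B≤R` the additional period costs at most `R`.
  cnt-bad≤ : ∀ n → 4 * D * cnt (λ v → bad χ L (suc v)) n ≤ R + suc n
  cnt-bad≤ n = begin
    4 * D * cnt (λ v → bad χ L (suc v)) n         ≤⟨ *-monoʳ-≤ (4 * D) (shift n) ⟩
    4 * D * cnt (bad χ L) (suc n)                 ≤⟨ *-monoʳ-≤ (4 * D) (cnt-monoʳ (bad χ L) 1+n≤) ⟩
    4 * D * cnt (bad χ L) (suc (suc n / R) * R)   ≡⟨ cong (4 * D *_) (cnt-bad χ L (suc (suc n / R))) ⟩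
    4 * D * (suc (suc n / R) * B)                 ≡⟨ swap (4 * D) (suc (suc n / R)) B ⟩
    suc (suc n / R) * (4 * D * B)                 ≤⟨ *-monoʳ-≤ (suc (suc n / R)) 4D*B≤R ⟩
    R + suc n / R * R                             ≤⟨ +-monoʳ-≤ R (m/n*n≤m (suc n) R) ⟩
    R + suc n                                     ∎
    where
    open ≤-Reasoning
    swap : ∀ s t u → s * (t * u) ≡ t * (s * u)
    swap = solve-∀
    shift : ∀ n → cnt (λ v → bad χ L (suc v)) n ≤ cnt (bad χ L) (suc n)
    shift zero    = z≤n
    shift (suc n) = +-monoʳ-≤ (indicator (bad χ L (suc n))) (shift n)
    1+n≤ : suc n ≤ suc (suc n / R) * R
    1+n≤ = begin
      suc n                             ≡⟨ m≡m%n+[m/n]*n (suc n) R ⟩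
      suc n % R + suc n / R * R         ≤⟨ +-monoˡ-≤ _ (m%n≤n (suc n) R) ⟩
      R + suc n / R * R                 ∎

  few : ∀ n → 2 + (R + 4 * D * R) ≤ n → ∀ F → Count P n F → (n ∸ F) * D < n
  few n N≤n F count = *-cancelˡ-< 4 _ _ (begin-strict
    4 * ((n ∸ F) * D)                                   ≡⟨ swap 4 (n ∸ F) D ⟩
    4 * D * (n ∸ F)                                     ≤⟨ *-monoʳ-≤ (4 * D) (m≤n+o⇒m∸n≤o n F n≤) ⟩
    4 * D * (R + K)                                     ≡⟨ *-distribˡ-+ (4 * D) R K ⟩
    4 * D * R + 4 * D * K                               ≤⟨ +-monoʳ-≤ (4 * D * R) (cnt-bad≤ n) ⟩
    4 * D * R + (R + suc n)                             <⟨ ≤-refl ⟩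
    suc (4 * D * R + (R + suc n))                       ≡⟨ regroup (4 * D * R) R n ⟩
    (2 + (R + 4 * D * R)) + n                           ≤⟨ +-monoˡ-≤ n N≤n ⟩
    n + n                                               ≤⟨ m≤m+n (n + n) (n + n) ⟩
    (n + n) + (n + n)                                   ≡⟨ four n ⟩
    4 * n                                               ∎)
    where
    open ≤-Reasoning
    K : ℕ
    K = cnt (λ v → bad χ L (suc v)) n
    n≤ : n ≤ F + (R + K)
    n≤ = ≤-trans (Count-lower (bad χ L) R good count) (≤-reflexive (reorder R F K))
      where
      reorder : ∀ r f k → r + f + k ≡ f + (r + k)
      reorder = solve-∀
    swap : ∀ s t u → s * (t * u) ≡ s * u * t
    swap = solve-∀
    regroup : ∀ s r n → suc (s + (r + suc n)) ≡ (2 + (r + s)) + n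
    regroup = solve-∀
    four : ∀ n → (n + n) + (n + n) ≡ 4 * n
    four = solve-∀

-- Recovering a move and its argument from the result.

^-distribʳ-* : ∀ m n x → (m * n) ^ x ≡ m ^ x * n ^ x
^-distribʳ-* m n zero    = refl
^-distribʳ-* m n (suc x) = trans (cong (m * n *_) (^-distribʳ-* m n x)) (swap m n (m ^ x) (n ^ x))
  where
  swap : ∀ s t u v → s * t * (u * v) ≡ s * u * (t * v)
  swap = solve-∀

^-cancelʳ-≡ : ∀ x .{{_ : NonZero x}} {m n} → m ^ x ≡ n ^ x → m ≡ n
^-cancelʳ-≡ x {m} {n} eq with <-cmp m n
... | tri< m<n _ _ = ⊥-elim (<-irrefl eq (^-monoˡ-< x m<n))
... | tri≈ _ m≡n _ = m≡n
... | tri> _ _ n<m = ⊥-elim (<-irrefl (sym eq) (^-monoˡ-< x n<m))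

module _ {p} (prime : Prime p) where

  private instance
    p≢0 : NonZero p
    p≢0 = prime⇒nonZero prime

  ∤-^ : ∀ {a} → p ∤ a → ∀ x → p ∤ a ^ x
  ∤-^ p∤a zero    p∣1 = ¬prime[1] (subst Prime (∣1⇒≡1 p∣1) prime)
  ∤-^ {a} p∤a (suc x) p∣  = [ p∤a , ∤-^ p∤a x ]′ (euclidsLemma a (a ^ x) prime p∣)

  -- Uniqueness of the `p`-adic valuation, by cancelling one factor `p` at a time.
  exponent-unique : ∀ x y {a a′} → p ∤ a → p ∤ a′ → p ^ x * a ≡ p ^ y * a′ → x ≡ y
  exponent-unique zero    zero    _   _    _  = refl
  exponent-unique zero    (suc y) {a} {a′} p∤a _ eq =
    ⊥-elim (p∤a (divides (p ^ y * a′) (trans (sym (+-identityʳ a)) (trans eq (rotate p (p ^ y) a′)))))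
    where
    rotate : ∀ s t u → s * t * u ≡ t * u * s
    rotate = solve-∀
  exponent-unique (suc x) zero    p∤a p∤a′ eq = sym (exponent-unique zero (suc x) p∤a′ p∤a (sym eq))
  exponent-unique (suc x) (suc y) {a} {a′} p∤a p∤a′ eq =
    cong suc (exponent-unique x y p∤a p∤a′ (*-cancelˡ-≡ _ _ p (trans (sym (*-assoc p (p ^ x) a)) (trans eq (*-assoc p (p ^ y) a′)))))

  -- The `p`-adic valuation of `(p * g) ^ x` is `x`, because `p` divides `p * g` exactly once; then
  -- an `x`-th root gives `g`.
  power-injective : ∀ {g h x y} → p ∤ g → p ∤ h → 0 < x → (p * g) ^ x ≡ (p * h) ^ y → g ≡ h × x ≡ y
  power-injective {g} {h} {x} {y} p∤g p∤h 0<x eq = *-cancelˡ-≡ g h p (^-cancelʳ-≡ x {{>-nonZero 0<x}} (trans eq (cong ((p * h) ^_) (sym x≡y)))) , x≡y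
    where
    x≡y : x ≡ y
    x≡y = exponent-unique x y (∤-^ p∤g x) (∤-^ p∤h y)
            (trans (sym (^-distribʳ-* p g x)) (trans eq (^-distribʳ-* p h y)))

  -- The shift c is read off modulo p ^ t, because p ^ t divides every (p g) ^ x with x ≥ t.
  shifted-power-injective : ∀ {t g h x y c e} → p ∤ g → p ∤ h → 0 < t → t ≤ x → t ≤ y → c < p ^ t → e < p ^ t →
    (p * g) ^ x + c ≡ (p * h) ^ y + e → g ≡ h × c ≡ e × x ≡ y
  shifted-power-injective {t} {g} {h} {x} {y} {c} {e} p∤g p∤h 0<t t≤x t≤y c< e< eq =
    let g≡h , x≡y = power-injective p∤g p∤h (<-≤-trans 0<t t≤x) (+-cancelʳ-≡ c _ _ (trans eq (cong ((p * h) ^ y +_) (sym c≡e))))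
    in g≡h , c≡e , x≡y
    where
    instance
      p^t≢0 : NonZero (p ^ t)
      p^t≢0 = m^n≢0 p t
    residue : ∀ g x c → t ≤ x → c < p ^ t → ((p * g) ^ x + c) % p ^ t ≡ c
    residue g x c t≤x c< = begin
      ((p * g) ^ x + c) % p ^ t                                  ≡⟨ cong (λ k → ((p * g) ^ k + c) % p ^ t) (m∸n+n≡m t≤x) ⟨
      ((p * g) ^ (x ∸ t + t) + c) % p ^ t                        ≡⟨ cong (λ k → (k + c) % p ^ t) (trans (^-distribˡ-+-* (p * g) (x ∸ t) t) (cong ((p * g) ^ (x ∸ t) *_) (^-distribʳ-* p g t))) ⟩
      ((p * g) ^ (x ∸ t) * (p ^ t * g ^ t) + c) % p ^ t          ≡⟨ cong (_% p ^ t) (rotate ((p * g) ^ (x ∸ t)) (p ^ t) (g ^ t) c) ⟩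
      (c + (p * g) ^ (x ∸ t) * g ^ t * p ^ t) % p ^ t            ≡⟨ [m+kn]%n≡m%n c ((p * g) ^ (x ∸ t) * g ^ t) (p ^ t) ⟩
      c % p ^ t                                                  ≡⟨ m<n⇒m%n≡m c< ⟩
      c                                                          ∎
      where
      open ≡-Reasoning
      rotate : ∀ s t u c → s * (t * u) + c ≡ c + s * u * t
      rotate = solve-∀
    c≡e : c ≡ e
    c≡e = trans (sym (residue g x c t≤x c<)) (trans (cong (_% p ^ t) eq) (residue h y e t≤y e<))

unique-map : ∀ {A B : Set} {P : A → Set} (f : A → B) → (∀ {x y} → P x → P y → f x ≡ f y → x ≡ y) →
             ∀ {xs} → Unique xs → All P xs → Unique (map f xs)
unique-map f inj []            []         = []
unique-map f inj (x∉ ∷ unique) (px ∷ pxs) =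
  Allₚ.map⁺ (All.zipWith (λ (x≢y , py) fx≡fy → x≢y (inj px py fx≡fy)) (x∉ , pxs)) ∷ unique-map f inj unique pxs

-- Elementary growth estimates.

-- Bernoulli's inequality with exponent `s` gives (1 + 1/s)^s ≥ 2, and `n` has room for `j` such
-- groups of factors.
power-doubling : ∀ s .{{_ : NonZero s}} n j → j * s ≤ n → 2 ^ j * s ^ n ≤ suc s ^ n
power-doubling s n zero    _  = subst (_≤ suc s ^ n) (sym (*-identityˡ (s ^ n))) (^-monoˡ-≤ n (n≤1+n s))
power-doubling s n (suc j) le = begin
  2 * 2 ^ j * s ^ n                            ≡⟨ cong (λ k → 2 * 2 ^ j * s ^ k) (m+[n∸m]≡n s≤n) ⟨
  2 * 2 ^ j * s ^ (s + (n ∸ s))                ≡⟨ cong (2 * 2 ^ j *_) (^-distribˡ-+-* s s (n ∸ s)) ⟩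
  2 * 2 ^ j * (s ^ s * s ^ (n ∸ s))            ≡⟨ regroup 2 (2 ^ j) (s ^ s) (s ^ (n ∸ s)) ⟩
  2 * s ^ s * (2 ^ j * s ^ (n ∸ s))            ≤⟨ *-mono-≤ doubling (power-doubling s (n ∸ s) j (m+n≤o⇒m≤o∸n (j * s) (subst (_≤ n) (+-comm s (j * s)) le))) ⟩
  suc s ^ s * suc s ^ (n ∸ s)                  ≡⟨ ^-distribˡ-+-* (suc s) s (n ∸ s) ⟨
  suc s ^ (s + (n ∸ s))                        ≡⟨ cong (suc s ^_) (m+[n∸m]≡n s≤n) ⟩
  suc s ^ n                                    ∎
  where
  open ≤-Reasoning
  s≤n : s ≤ n
  s≤n = ≤-trans (m≤m+n s (j * s)) le
  regroup : ∀ a b c d → a * b * (c * d) ≡ a * c * (b * d)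
  regroup = solve-∀
  doubling : 2 * s ^ s ≤ suc s ^ s
  doubling = *-cancelˡ-≤ s (subst (_≤ s * suc s ^ s) (twice s (s ^ s)) (bernoulli s s))
    where
    twice : ∀ s w → (s + s) * w ≡ s * (2 * w)
    twice = solve-∀

n<2^n : ∀ n → n < 2 ^ n
n<2^n zero    = ≤-refl
n<2^n (suc n) = begin
  2 + n              ≤⟨ s≤s (n<2^n n) ⟩
  1 + 2 ^ n          ≤⟨ +-mono-≤ (m^n>0 2 n) (m≤m+n (2 ^ n) 0) ⟩
  2 ^ suc n          ∎
  where open ≤-Reasoning

-- With R = 1 + α + γ the left side is at most R², and R < 2^R. It lets `abundant` choose a window
-- length that exceeds a linear overhead.
linear≤power : ∀ {b} → 1 < b → ∀ α γ → α * suc (α + γ) + γ ≤ b ^ (2 * suc (α + γ))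
linear≤power {b} 1<b α γ = begin
  α * R + γ                ≤⟨ +-mono-≤ (*-monoˡ-≤ R (m≤m+n α γ)) (m≤n⇒m≤1+n (m≤n+m γ α)) ⟩
  (α + γ) * R + R          ≡⟨ +-comm _ R ⟩
  R * R                    ≤⟨ *-mono-≤ (<⇒≤ (n<2^n R)) (<⇒≤ (n<2^n R)) ⟩
  2 ^ R * 2 ^ R            ≡⟨ ^-distribˡ-+-* 2 R R ⟨
  2 ^ (R + R)              ≡⟨ cong (λ k → 2 ^ (R + k)) (+-identityʳ R) ⟨
  2 ^ (2 * R)              ≤⟨ ^-monoˡ-≤ (2 * R) 1<b ⟩
  b ^ (2 * R)              ∎
  where
  open ≤-Reasoning
  R : ℕ
  R = suc (α + γ)

-- From counts to the rational limit.

n/n≡1ℚ : ∀ n .{{_ : NonZero n}} → (ℤ.+ n) ℚ./ n ≡ 1ℚ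
n/n≡1ℚ n@(suc n-1) = ℚₚ.toℚᵘ-injective
  (ℚᵘₚ.≃-trans (ℚₚ.toℚᵘ-fromℚᵘ (mkℚᵘ (ℤ.+ n) n-1)) (*≡* (ℤₚ.*-comm (ℤ.+ n) (ℤ.+ 1))))

∣F/n-1∣≡[n∸F]/n : ∀ {n F} .{{_ : NonZero n}} → F ≤ n → ℚ.∣ (ℤ.+ F) ℚ./ n ℚ.- 1ℚ ∣ ≡ (ℤ.+ (n ∸ F)) ℚ./ n
∣F/n-1∣≡[n∸F]/n {n} {F} F≤n = begin
  ℚ.∣ f ℚ.- 1ℚ ∣                     ≡⟨ cong (λ z → ℚ.∣ f ℚ.- z ∣) f+g≡1 ⟨
  ℚ.∣ f ℚ.- (f ℚ.+ g) ∣              ≡⟨ cong ℚ.∣_∣ (cancel f g) ⟩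
  ℚ.∣ ℚ.- g ∣                        ≡⟨ ℚₚ.∣-p∣≡∣p∣ g ⟩
  ℚ.∣ g ∣                            ≡⟨ ℚₚ.0≤p⇒∣p∣≡p (ℚₚ.nonNegative⁻¹ g {{ℚₚ.normalize-nonNeg (n ∸ F) n}}) ⟩
  g                                  ∎
  where
  open ≡-Reasoning
  f g : ℚ
  f = (ℤ.+ F) ℚ./ n
  g = (ℤ.+ (n ∸ F)) ℚ./ n
  f+g≡1 : f ℚ.+ g ≡ 1ℚ
  f+g≡1 = trans (/-+ F (n ∸ F) n) (trans (cong (λ k → (ℤ.+ k) ℚ./ n) (m+[n∸m]≡n F≤n)) (n/n≡1ℚ n))
  cancel : ∀ f g → f ℚ.- (f ℚ.+ g) ≡ ℚ.- g
  cancel = solve 2 (λ f g → f :- (f :+ g) := :- g) refl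
    where open +-*-Solver

-- A positive ε is at least 1 over its denominator, so it suffices that (n - F)/n lies below that
-- reciprocal.
fraction-close : ∀ {n F} .{{_ : NonZero n}} ε → 0ℚ ℚ.< ε → F ≤ n → (n ∸ F) * ℚ.denominatorℕ ε < n →
                 ℚ.∣ (ℤ.+ F) ℚ./ n ℚ.- 1ℚ ∣ ℚ.< ε
fraction-close (mkℚ (ℤ.+ 0) _ _)        (ℚ.*<* (ℤ.+<+ ()))
fraction-close (mkℚ (ℤ.-[1+ _ ]) _ _) (ℚ.*<* ())
fraction-close {n@(suc n-1)} {F} ε@(mkℚ ℤ.+[1+ a ] e _) 0<ε F≤n few =
  subst (ℚ._< ε) (sym (∣F/n-1∣≡[n∸F]/n F≤n)) (ℚₚ.toℚᵘ-cancel-< (begin-strict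
    ℚ.toℚᵘ ((ℤ.+ (n ∸ F)) ℚ./ n)      ≃⟨ ℚₚ.toℚᵘ-fromℚᵘ (mkℚᵘ (ℤ.+ (n ∸ F)) n-1) ⟩
    mkℚᵘ (ℤ.+ (n ∸ F)) n-1            <⟨ *<* (subst₂ ℤ._<_ (ℤₚ.pos-* (n ∸ F) (suc e)) (ℤₚ.pos-* (suc a) n) (ℤ.+<+ (<-≤-trans few (m≤m+n n (a * n))))) ⟩
    ℚ.toℚᵘ ε                        ∎))
  where open ℚᵘₚ.≤-Reasoning

-- Moves and their costs.

module Moves {b : ℕ} (d : Digit b) (p t O : ℕ) where

  open Copying d

  -- A move replaces x by (p * factor) ^ x + (shift - O); the offset O keeps negative constants in ℕ.
  record Move : Set where
    field
      cost factor shift : ℕ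
      apply : ∀ {n x} → O ≤ (p * factor) ^ x → Copies n x → Copies (cost + n) (((p * factor) ^ x + shift) ∸ O)

  open Move

  -- `p` divides `p * factor` exactly once, and the shift is a reduced residue modulo `p ^ t`. A
  -- positive cost makes recursion on the number of copies descend; `J` bounds how far it looks
  -- back.
  Admissible : ℕ → Move → Set
  Admissible J m = p ∤ factor m × shift m < p ^ t × 1 ≤ cost m × cost m ≤ J

  Distinct : Move → Move → Set
  Distinct m m′ = ¬ (factor m ≡ factor m′ × shift m ≡ shift m′)

  -- The Kraft term (u/v)^(-cost), multiplied by u^J to stay in ℕ.
  weight : ℕ → ℕ → ℕ → Move → ℕ
  weight u v J m = v ^ cost m * u ^ (J ∸ cost m)

  data Power : Set where
    power : ∀ {γ} f .{{_ : NonZero (p * f)}} → Copies γ (p * f) → Power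

  -- The bound is Boolean, so that for explicit constants it is settled by evaluation.
  data Constant : Set where
    constant : ∀ {κ c} {c≤O : T (c ≤ᵇ O)} → Copies κ c → Constant

  plain : Power → Move
  plain (power {γ} f P) = record
    { cost = γ ; factor = f ; shift = O
    ; apply = λ {_} {x} _ X → subst (Copies _) (sym (m+n∸n≡m ((p * f) ^ x) O)) (P ↑ X) }

  plus : Power → Constant → Move
  plus (power {γ} f P) (constant {κ} {c} C) = record
    { cost = κ + γ ; factor = f ; shift = c + O
    ; apply = λ {n} {x} _ X →
        subst₂ Copies (sym (+-assoc κ γ n))
          (sym (trans (cong (_∸ O) (sym (+-assoc ((p * f) ^ x) c O)))
                      (trans (m+n∸n≡m ((p * f) ^ x + c) O) (+-comm ((p * f) ^ x) c))))
          (C ⊕ (P ↑ X)) }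

  -- Here `apply` needs its hypothesis: `c ≤ O` and `O ≤ (p * f) ^ x` keep the subtraction from
  -- truncating.
  minus : Power → Constant → Move
  minus (power {γ} f P) (constant {κ} {c} {T≤} C) = record
    { cost = κ + γ ; factor = f ; shift = O ∸ c
    ; apply = λ {n} {x} O≤ X →
        subst₂ Copies (trans (+-comm (γ + n) κ) (sym (+-assoc κ γ n))) (sym (shifted ((p * f) ^ x)))
          (difference (≤-trans c≤O O≤) (P ↑ X) C) }
    where
    c≤O : c ≤ O
    c≤O = ≤ᵇ⇒≤ c O T≤
    shifted : ∀ y → y + (O ∸ c) ∸ O ≡ y ∸ c
    shifted y = begin
      y + (O ∸ c) ∸ O                    ≡⟨ cong (y + (O ∸ c) ∸_) (m∸n+n≡m c≤O) ⟨
      y + (O ∸ c) ∸ (O ∸ c + c)          ≡⟨ ∸-+-assoc (y + (O ∸ c)) (O ∸ c) c ⟨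
      y + (O ∸ c) ∸ (O ∸ c) ∸ c          ≡⟨ cong (_∸ c) (m+n∸n≡m y (O ∸ c)) ⟩
      y ∸ c                              ∎
      where open ≡-Reasoning

  moves-from : List Power → List Constant → List Move
  moves-from Ps Cs = concatMap (λ P → plain P ∷ concatMap (λ C → plus P C ∷ minus P C ∷ []) Cs) Ps

  admissible? : ∀ J (ms : List Move) → Dec (All (Admissible J) ms)
  admissible? J = All.all? λ m → ¬? (p ∣? factor m) ×-dec shift m <? p ^ t ×-dec 1 ≤? cost m ×-dec cost m ≤? J

  distinct? : ∀ (ms : List Move) → Dec (AllPairs Distinct ms)
  distinct? = AllPairs.allPairs? λ m m′ → ¬? ((factor m ≟ factor m′) ×-dec (shift m ≟ shift m′))

  -- Exponentially many numbers reached by the moves.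

  module Growth (1<b : 1 < b) (d+1≡b : suc (toℕ d) ≡ b) (prime : Prime p) (0<t : 0 < t) (O+t≤ : O + t ≤ p ^ t)
                (moves : List Move) (J : ℕ)
                (admissible : All (Admissible J) moves) (distinct : AllPairs Distinct moves)
                (v : ℕ) .{{v≢0 : NonZero v}}
                -- The sum of (b + 1 / v) ^ (- cost) over the moves is at least 1, cleared of denominators.
                (kraft : suc (b * v) ^ J ≤ sum (map (weight (suc (b * v)) v J) moves)) where

    u : ℕ
    u = suc (b * v)

    private instance
      b≢0 : NonZero b
      b≢0 = >-nonZero (<-trans z<s 1<b)
      p≢0 : NonZero p
      p≢0 = prime⇒nonZero prime

    -- Large enough for the one-element families of `seed` to satisfy the size bound.
    A : ℕ
    A = u ^ (t + J)

    Reaches : ℕ → ℕ → Set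
    Reaches n x = t ≤ x × Copies n x

    -- The field `large` asks for at least (b + 1/v)^n / A members. The bound `t ≤ x` in `Reaches`
    -- is what the injectivity of moves requires.
    record Family (n : ℕ) : Set where
      constructor family
      field
        members : List ℕ
        unique  : Unique members
        reaches : All (Reaches n) members
        large   : u ^ n ≤ A * v ^ n * length members

    image : Move → ℕ → ℕ
    image m x = ((p * factor m) ^ x + shift m) ∸ O

    p^t≤power : ∀ m {x} → p ∤ factor m → t ≤ x → p ^ t ≤ (p * factor m) ^ x
    p^t≤power m {x} p∤ t≤x = ≤-trans (^-monoʳ-≤ p t≤x) (^-monoˡ-≤ x (m≤m*n p (factor m) {{≢-nonZero λ eq → p∤ (divides 0 eq)}}))

    -- The image is at least `p ^ t - O`, and `O + t ≤ p ^ t`. The bound by `t` thus survives, so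
    -- moves can be iterated.
    t≤image : ∀ m {x} → p ∤ factor m → t ≤ x → t ≤ image m x
    t≤image m {x} p∤ t≤x = begin
      t                                         ≡⟨ m+n∸m≡n O t ⟨
      O + t ∸ O                                 ≤⟨ ∸-monoˡ-≤ O (≤-trans O+t≤ (≤-trans (p^t≤power m p∤ t≤x) (m≤m+n _ (shift m)))) ⟩
      image m x                                 ∎
      where open ≤-Reasoning

    -- Neither subtraction of `O` truncates, so the offset cancels and `shifted-power-injective`
    -- applies. In particular distinct moves have disjoint images.
    image-injective : ∀ m m′ {x y} → Admissible J m → Admissible J m′ → t ≤ x → t ≤ y → image m x ≡ image m′ y →
                      (factor m ≡ factor m′ × shift m ≡ shift m′) × x ≡ y
    image-injective m m′ (p∤ , s< , _) (p∤′ , s<′ , _) t≤x t≤y eq =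
      let f≡ , s≡ , x≡y = shifted-power-injective prime p∤ p∤′ 0<t t≤x t≤y s< s<′ (∸-cancelʳ-≡ (O≤ m p∤ t≤x) (O≤ m′ p∤′ t≤y) eq)
      in (f≡ , s≡) , x≡y
      where
      O≤ : ∀ m {x} → p ∤ factor m → t ≤ x → O ≤ (p * factor m) ^ x + shift m
      O≤ m p∤ t≤x = ≤-trans (m≤m+n O t) (≤-trans O+t≤ (≤-trans (p^t≤power m p∤ t≤x) (m≤m+n _ (shift m))))

    -- The union of the images under the moves treated so far. `origin` remembers how each member
    -- arose, which is needed to show it apart from the images under the next move.
    record Images (n : ℕ) (ms : List Move) : Set where
      field
        members : List ℕ
        unique  : Unique members
        reaches : All (Reaches n) members
        origin  : All (λ z → ∃[ m ] ∃[ x ] m ∈ ms × t ≤ x × z ≡ image m x) members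
        large   : sum (map (weight u v J) ms) * u ^ (n ∸ J) ≤ A * v ^ n * length members

    images : ∀ n → J ≤ n → (∀ e → 1 ≤ e → e ≤ J → Family (n ∸ e)) →
             ∀ {ms} → All (Admissible J) ms → AllPairs Distinct ms → Images n ms
    images n J≤n fam [] [] = record
      { members = [] ; unique = [] ; reaches = [] ; origin = [] ; large = z≤n }
    images n J≤n fam {m ∷ ms} (adm@(p∤ , s< , 1≤e , e≤J) ∷ adms) (dist ∷ dists) = record
      { members = map (image m) F.members ++ I.members
      ; unique  = AllPairsₚ.++⁺
          (unique-map (image m) (λ t≤x t≤y eq → proj₂ (image-injective m m adm adm t≤x t≤y eq)) F.unique (All.map proj₁ F.reaches))
          I.unique
          (Allₚ.map⁺ (All.map (λ (t≤x , _) → All.map (apart t≤x) I.origin) F.reaches))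
      ; reaches = Allₚ.++⁺ (Allₚ.map⁺ (All.map step F.reaches)) I.reaches
      ; origin  = Allₚ.++⁺ (Allₚ.map⁺ (All.map (λ (t≤x , _) → m , _ , here refl , t≤x , refl) F.reaches))
                           (All.map (λ (m′ , x , m′∈ , rest) → m′ , x , there m′∈ , rest) I.origin)
      ; large   = large
      }
      where
      e : ℕ
      e = cost m
      module F = Family (fam e 1≤e e≤J)
      module I = Images (images n J≤n fam adms dists)

      step : ∀ {x} → Reaches (n ∸ e) x → Reaches n (image m x)
      step (t≤x , X) = t≤image m p∤ t≤x , subst (λ k → Copies k _) (m+[n∸m]≡n (≤-trans e≤J J≤n)) (apply m (≤-trans (≤-trans (m≤m+n O t) O+t≤) (p^t≤power m p∤ t≤x)) X)

      apart : ∀ {x z} → t ≤ x → (∃[ m′ ] ∃[ y ] m′ ∈ ms × t ≤ y × z ≡ image m′ y) → image m x ≢ z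
      apart t≤x (m′ , y , m′∈ , t≤y , refl) eq =
        All.lookup dist m′∈ (proj₁ (image-injective m m′ adm (All.lookup adms m′∈) t≤x t≤y eq))

      w : ℕ
      w = sum (map (weight u v J) ms)

      large : (v ^ e * u ^ (J ∸ e) + w) * u ^ (n ∸ J) ≤ A * v ^ n * length (map (image m) F.members ++ I.members)
      large = begin
        (v ^ e * u ^ (J ∸ e) + w) * u ^ (n ∸ J)                          ≡⟨ *-distribʳ-+ (u ^ (n ∸ J)) (v ^ e * u ^ (J ∸ e)) w ⟩
        v ^ e * u ^ (J ∸ e) * u ^ (n ∸ J) + w * u ^ (n ∸ J)              ≡⟨ cong (_+ w * u ^ (n ∸ J)) (*-assoc (v ^ e) _ _) ⟩
        v ^ e * (u ^ (J ∸ e) * u ^ (n ∸ J)) + w * u ^ (n ∸ J)            ≡⟨ cong (λ k → v ^ e * k + w * u ^ (n ∸ J)) (^-distribˡ-+-* u (J ∸ e) (n ∸ J)) ⟨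
        v ^ e * u ^ (J ∸ e + (n ∸ J)) + w * u ^ (n ∸ J)                  ≡⟨ cong (λ k → v ^ e * u ^ k + w * u ^ (n ∸ J)) exponent ⟩
        v ^ e * u ^ (n ∸ e) + w * u ^ (n ∸ J)                            ≤⟨ +-mono-≤ (*-monoʳ-≤ (v ^ e) F.large) I.large ⟩
        v ^ e * (A * v ^ (n ∸ e) * f) + A * v ^ n * i                    ≡⟨ cong (_+ A * v ^ n * i) (regroup (v ^ e) A (v ^ (n ∸ e)) f) ⟩
        A * (v ^ e * v ^ (n ∸ e)) * f + A * v ^ n * i                    ≡⟨ cong (λ k → A * k * f + A * v ^ n * i) (^-distribˡ-+-* v e (n ∸ e)) ⟨
        A * v ^ (e + (n ∸ e)) * f + A * v ^ n * i                        ≡⟨ cong (λ k → A * v ^ k * f + A * v ^ n * i) (m+[n∸m]≡n (≤-trans e≤J J≤n)) ⟩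
        A * v ^ n * f + A * v ^ n * i                                    ≡⟨ *-distribˡ-+ (A * v ^ n) f i ⟨
        A * v ^ n * (f + i)                                              ≡⟨ cong (λ k → A * v ^ n * (k + i)) (length-map (image m) F.members) ⟨
        A * v ^ n * (length (map (image m) F.members) + i)               ≡⟨ cong (A * v ^ n *_) (length-++ (map (image m) F.members)) ⟨
        A * v ^ n * length (map (image m) F.members ++ I.members)        ∎
        where
        open ≤-Reasoning
        f i : ℕ
        f = length F.members
        i = length I.members
        exponent : J ∸ e + (n ∸ J) ≡ n ∸ e
        exponent = trans (+-comm (J ∸ e) (n ∸ J)) (trans (sym (+-∸-assoc (n ∸ J) e≤J)) (cong (_∸ e) (m∸n+n≡m J≤n)))
        regroup : ∀ s a t k → s * (a * t * k) ≡ a * (s * t) * k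
        regroup = solve-∀

    -- The sum of `n` copies of `d` is at least `n`, hence at least `t`. The `J` consecutive base
    -- cases suffice because no move costs more than `J`.
    seed : ∀ n → t ≤ n → n < t + J → Family n
    seed zero    t≤n _ = ⊥-elim (<⇒≱ 0<t t≤n)
    seed n@(suc k) t≤n n< = family [ n * toℕ d ] ([] ∷ [])
      ((≤-trans t≤n (m≤m*n n (toℕ d) {{>-nonZero (≤-pred (subst (1 <_) (sym d+1≡b) 1<b))}}) , copies-sum k) ∷ [])
      (begin
        u ^ n              ≤⟨ ^-monoʳ-≤ u (<⇒≤ n<) ⟩
        A                  ≤⟨ m≤m*n A (v ^ n) {{m^n≢0 v n}} ⟩
        A * v ^ n          ≡⟨ *-identityʳ _ ⟨
        A * v ^ n * 1      ∎)
      where open ≤-Reasoning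

    -- The images of the families for `n ∸ cost` are united; by `kraft` their sizes add up to the
    -- growth rate u/v = b + 1/v.
    families : ∀ n → t ≤ n → Family n
    families = <-rec _ go
      where
      go : ∀ n → (∀ {k} → k < n → t ≤ k → Family k) → t ≤ n → Family n
      go n rec t≤n with n <? t + J
      ... | yes n< = seed n t≤n n<
      ... | no  n≮ = family I.members I.unique I.reaches (begin
          u ^ n                                                  ≡⟨ cong (u ^_) (m+[n∸m]≡n J≤n) ⟨
          u ^ (J + (n ∸ J))                                      ≡⟨ ^-distribˡ-+-* u J (n ∸ J) ⟩
          u ^ J * u ^ (n ∸ J)                                    ≤⟨ *-monoˡ-≤ (u ^ (n ∸ J)) kraft ⟩
          sum (map (weight u v J) moves) * u ^ (n ∸ J)           ≤⟨ I.large ⟩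
          A * v ^ n * length I.members                           ∎)
        where
        open ≤-Reasoning
        t+J≤n : t + J ≤ n
        t+J≤n = ≮⇒≥ n≮
        J≤n : J ≤ n
        J≤n = ≤-trans (m≤n+m J t) t+J≤n
        smaller : ∀ e → 1 ≤ e → e ≤ J → Family (n ∸ e)
        smaller e 1≤e e≤J = rec (∸-monoʳ-< 1≤e (≤-trans e≤J J≤n))
          (≤-trans (m+n≤o⇒m≤o∸n t t+J≤n) (∸-monoʳ-≤ n e≤J))
        module I = Images (images n J≤n smaller admissible distinct)

    -- A window of m = b^r - 1 copies leaves `n` for `x` after an overhead of 2r + κ. The gain (1 +
    -- 1/s)^n over b^n, where s = b v, beats the factor A K b^(2r+κ), as `n` is exponential in `r`.
    abundant : ∀ K κ → ∃[ r ] ∃[ n ] 0 < r × 0 < n × suc (n + 2 * r + κ) ≡ b ^ r ×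
               ∃[ f ] K * b ^ (n + 2 * r + κ) ≤ length (Family.members {n} f)
    abundant K κ = r , n , z<s , <-≤-trans 0<t t≤n , 1+m≡ , families n t≤n ,
      *-cancelˡ-≤ (A * v ^ n) (begin
        A * v ^ n * (K * b ^ (n + 2 * r + κ))                 ≡⟨ cong (λ k → A * v ^ n * (K * k)) (trans (^-distribˡ-+-* b (n + 2 * r) κ) (cong (_* b ^ κ) (^-distribˡ-+-* b n (2 * r)))) ⟩
        A * v ^ n * (K * (b ^ n * b ^ (2 * r) * b ^ κ))       ≡⟨ regroup A (v ^ n) K (b ^ n) (b ^ (2 * r)) (b ^ κ) ⟩
        b ^ (2 * r) * (A * K * b ^ κ) * (b ^ n * v ^ n)       ≡⟨ cong (b ^ (2 * r) * C *_) (^-distribʳ-* b v n) ⟨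
        -- The crude bounds b < 2^b and C < 2^C turn the overhead into a power of 2 that
        -- `power-doubling` can absorb.
        b ^ (2 * r) * C * s ^ n                               ≤⟨ *-monoˡ-≤ (s ^ n) (*-mono-≤ (^-monoˡ-≤ (2 * r) (<⇒≤ (n<2^n b))) (<⇒≤ (n<2^n C))) ⟩
        (2 ^ b) ^ (2 * r) * 2 ^ C * s ^ n                     ≡⟨ cong (λ k → k * 2 ^ C * s ^ n) (^-*-assoc 2 b (2 * r)) ⟩
        2 ^ (b * (2 * r)) * 2 ^ C * s ^ n                     ≡⟨ cong (_* s ^ n) (^-distribˡ-+-* 2 (b * (2 * r)) C) ⟨
        2 ^ j * s ^ n                                         ≤⟨ power-doubling s n j js≤n ⟩
        suc s ^ n                                             ≤⟨ Family.large (families n t≤n) ⟩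
        A * v ^ n * length (Family.members (families n t≤n))         ∎)
      where
      open ≤-Reasoning
      s C α γ R r j n : ℕ
      s = b * v
      C = A * K * b ^ κ
      -- With `r = 2 * R`, the length to be accommodated, `j * s + t + suc (2 * r + κ)`, is exactly
      -- `α * R + γ`.
      α = 4 * b * s + 4
      γ = s * C + t + suc κ
      R = suc (α + γ)
      r = 2 * R
      j = b * (2 * r) + C
      n = b ^ r ∸ suc (2 * r + κ)

      instance
        s≢0 : NonZero s
        s≢0 = m*n≢0 b v
        A*v^n≢0 : NonZero (A * v ^ n)
        A*v^n≢0 = m*n≢0 A (v ^ n) {{m^n≢0 u (t + J)}} {{m^n≢0 v n}}

      regroup : ∀ A V K B R c → A * V * (K * (B * R * c)) ≡ R * (A * K * c) * (B * V)
      regroup = solve-∀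

      enough : j * s + t + suc (2 * r + κ) ≤ b ^ r
      enough = ≤-trans (≤-reflexive (expand b s C t κ R)) (linear≤power 1<b α γ)
        where
        expand : ∀ b s C t κ R → (b * (2 * (2 * R)) + C) * s + t + suc (2 * (2 * R) + κ)
                                 ≡ (4 * b * s + 4) * R + (s * C + t + suc κ)
        expand = solve-∀

      js+t≤n : j * s + t ≤ n
      js+t≤n = m+n≤o⇒m≤o∸n (j * s + t) enough

      js≤n : j * s ≤ n
      js≤n = ≤-trans (m≤m+n (j * s) t) js+t≤n

      t≤n : t ≤ n
      t≤n = ≤-trans (m≤n+m t (j * s)) js+t≤n

      1+m≡ : suc (n + 2 * r + κ) ≡ b ^ r
      1+m≡ = trans (cong suc (+-assoc n (2 * r) κ)) (trans (sym (+-suc n (2 * r + κ)))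
               (m∸n+n≡m (≤-trans (m≤n+m _ (j * s + t)) enough)))

    -- Density in one base.

    module _ {ω β} (one : Copies ω 1) (base : Copies β b) where

      -- Q = b^m costs only `β + suc r` copies, since its exponent `m` is the block of `suc r` top
      -- digits. Two copies of Q and two of 1 make up the overhead.
      window-numbers-are-nice : ∀ {r n m q x} → n + 2 * suc r + 2 * (ω + β) ≡ m → suc m ≡ b ^ suc r → suc q ≡ b ^ m →
        0 < n → Reaches n x → ∀ P S → 0 < P → S < suc q ^ x → NiceFriedman b ((P * suc q + q) * suc q ^ x + S)
      window-numbers-are-nice {r} {n} {m} {q} {x} m≡ 1+m≡ Q≡ 0<n (t≤x , X) P S 0<P S< =
        nice-of-window 1<b d+1≡b Q≡ (trans (regroup ω β r n) m≡) one Q X P S 0<P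
          (*-mono-≤ (≤-trans 0<n (≤-trans (≤-trans (m≤m+n n _) (m≤m+n _ _)) (≤-reflexive m≡))) (≤-trans 0<t t≤x)) S<
        where
        Q : Copies (β + suc r) (suc q)
        Q = subst (Copies (β + suc r))
              (trans (cong (b ^_) (suc-injective (trans (val-replicate-max d d+1≡b (suc r)) (sym 1+m≡)))) (sym Q≡))
              (base ↑ copies-block r)
        regroup : ∀ ω β r n → ω + ((β + suc r) + (ω + ((β + suc r) + n))) ≡ n + 2 * suc r + 2 * (ω + β)
        regroup = solve-∀

      nice-of-family : ∀ D {r n m q} → n + 2 * suc r + 2 * (ω + β) ≡ m → suc m ≡ b ^ suc r → suc q ≡ b ^ m →
        0 < n → (f : Family n) → 4 * D * b ^ m ≤ length (Family.members f) →
        ∃[ N ] ∀ k → N ≤ k → ∀ F → Count (NiceFriedman b) k F → F ≤ k × (k ∸ F) * D < k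
      nice-of-family D {n = n} {m} {q} m≡ 1+m≡ Q≡ 0<n f many =
        density (NiceFriedman b) q {{>-nonZero (≤-pred 2≤Q)}} D (Family.members f) (Family.unique f)
          (≤-trans (*-monoʳ-≤ (4 * D) (≤-trans (n≤1+n q) (≤-reflexive Q≡))) many)
          (λ x P S x∈ 0<P S< → window-numbers-are-nice m≡ 1+m≡ Q≡ 0<n (All.lookup (Family.reaches f) x∈) P S 0<P S<)
        where
        open ≤-Reasoning
        2≤Q : 2 ≤ suc q
        2≤Q = begin
          2            ≤⟨ 1<b ⟩
          b            ≡⟨ *-identityʳ b ⟨
          b ^ 1        ≤⟨ ^-monoʳ-≤ b (≤-trans 0<n (≤-trans (≤-trans (m≤m+n n _) (m≤m+n _ _)) (≤-reflexive m≡))) ⟩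
          b ^ m        ≡⟨ Q≡ ⟨
          suc q        ∎

      -- Taking `K = 4 * D` in `abundant` gives the number of positions that `density` demands.
      misses-are-sparse : ∀ D → ∃[ N ] ∀ k → N ≤ k → ∀ F → Count (NiceFriedman b) k F → F ≤ k × (k ∸ F) * D < k
      misses-are-sparse D = choose (abundant (4 * D) (2 * (ω + β)))
        where
        choose : (∃[ r ] ∃[ n ] 0 < r × 0 < n × suc (n + 2 * r + 2 * (ω + β)) ≡ b ^ r ×
                  ∃[ f ] 4 * D * b ^ (n + 2 * r + 2 * (ω + β)) ≤ length (Family.members {n} f)) →
                 ∃[ N ] ∀ k → N ≤ k → ∀ F → Count (NiceFriedman b) k F → F ≤ k × (k ∸ F) * D < k
        choose (suc r , n , _ , 0<n , 1+m≡ , f , many) =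
          nice-of-family D refl 1+m≡ (suc-pred _ {{m^n≢0 b (n + 2 * suc r + 2 * (ω + β))}}) 0<n f many

      nice-density : (ε : ℚ) → 0ℚ ℚ.< ε →
        ∃[ N ] ((n : ℕ) .{{_ : NonZero n}} → N ≤ n →
          (F : ℕ) → Count (NiceFriedman b) n F → ℚ.∣ (ℤ.+ F) ℚ./ n ℚ.- 1ℚ ∣ ℚ.< ε)
      nice-density ε 0<ε = proj₁ few , λ n N≤n F count →
          fraction-close ε 0<ε (proj₁ (proj₂ few n N≤n F count)) (proj₂ (proj₂ few n N≤n F count))
        where few = misses-are-sparse (ℚ.denominatorℕ ε)

-- Explicit moves for the three bases.

module Binary where

  open Copying {2} (# 1) public
  open Moves {2} (# 1) 3 2 3

  one : Copies 1 1
  one = copies-block 0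

  two : Copies 2 2
  two = one ⊕ one

  three : Copies 2 3
  three = copies-block 1

  -- The sum of 2^(-cost) is 9/8: the powers of 3, 6, 15 have costs 2, 4, 4, and each admits the
  -- shifts 0, ±1, ±2, ±3. The surplus permits growth rate 2 + 1/20.
  moves : List Move
  moves = moves-from
    (power 1 three ∷ power 2 (three ⊕ three) ∷ power 5 (copies-block 3) ∷ [])
    (constant one ∷ constant two ∷ constant three ∷ [])

  open Growth (≤ᵇ⇒≤ _ _ _) refl (from-yes (prime? 3)) z<s (≤ᵇ⇒≤ _ _ _) moves 6
    (from-yes (admissible? 6 moves)) (from-yes (distinct? moves)) 20 (≤ᵇ⇒≤ _ _ _) public

module Ternary where

  open Copying {3} (# 2) public
  open Moves {3} (# 2) 2 5 8

  two : Copies 1 2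
  two = copies-block 0

  one : Copies 2 1
  one = quotient 1 two two

  eight : Copies 2 8
  eight = copies-block 1

  -- The factor from the powers of 2, 6, 10, 26 is 1/3 + 3/27 = 4/9, that from the shifts is 1 +
  -- 2(1/3 + 3/9) = 7/3. The sum of 3^(-cost) is 28/27, enough for growth rate 3 + 1/25.
  moves : List Move
  moves = moves-from
    (power 1 two ∷ power 3 (two ⊕ two ⊕ two) ∷ power 5 (eight ⊕ two) ∷ power 13 (copies-block 2) ∷ [])
    (constant one ∷ constant two ∷ constant (two ⊗ two) ∷ constant eight ∷ [])

  open Growth (≤ᵇ⇒≤ _ _ _) refl (from-yes (prime? 2)) z<s (≤ᵇ⇒≤ _ _ _) moves 5
    (from-yes (admissible? 5 moves)) (from-yes (distinct? moves)) 25 (≤ᵇ⇒≤ _ _ _) public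

module Quaternary where

  open Copying {4} (# 3) public
  open Moves {4} (# 3) 3 5 63

  three : Copies 1 3
  three = copies-block 0

  one : Copies 2 1
  one = quotient 1 three three

  six : Copies 2 6
  six = three ⊕ three

  fifteen : Copies 2 15
  fifteen = copies-block 1

  twenty-seven : Copies 2 27
  twenty-seven = three ↑ three

  twelve : Copies 3 12
  twelve = difference (≤ᵇ⇒≤ 3 15 _) fifteen three

  twenty-four : Copies 3 24
  twenty-four = difference (≤ᵇ⇒≤ 3 27 _) twenty-seven three

  thirty : Copies 3 30
  thirty = twenty-seven ⊕ three

  -- The factor from the powers is 1/4 + 2/16 + 3/64 = 27/64, that from the shifts is 1 + 2(1/4 +
  -- 5/16 + 9/64) = 77/32. The sum of 4^(-cost) is 2079/2048, barely above 1, which is why the lists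
  -- are long and the growth rate is only 4 + 1/60.
  moves : List Move
  moves = moves-from
    (power 1 three ∷ power 2 six ∷ power 5 fifteen ∷ power 4 twelve ∷ power 8 twenty-four ∷ power 10 thirty ∷ [])
    ( constant one ∷ constant three ∷ constant six ∷ constant (three ⊗ three) ∷ constant fifteen ∷ constant twenty-seven
    ∷ constant (quotient 2 six three) ∷ constant (one ⊕ three) ∷ constant (quotient 5 fifteen three) ∷ constant twelve
    ∷ constant (fifteen ⊕ three) ∷ constant twenty-four ∷ constant thirty ∷ constant (fifteen ⊗ three)
    ∷ constant (copies-block 2) ∷ [])

  open Growth (≤ᵇ⇒≤ _ _ _) refl (from-yes (prime? 3)) z<s (≤ᵇ⇒≤ _ _ _) moves 6
    (from-yes (admissible? 6 moves)) (from-yes (distinct? moves)) 60 (≤ᵇ⇒≤ _ _ _) public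

theorem2 : (b : ℕ) → (b ≡ 2 ⊎ b ≡ 3 ⊎ b ≡ 4) →
    (ε : ℚ) → 0ℚ ℚ.< ε →
    ∃[ N ] ((n : ℕ) .{{_ : NonZero n}} → N ≤ n →
      (F : ℕ) → Count (NiceFriedman b) n F → ℚ.∣ (ℤ.+ F) ℚ./ n ℚ.- 1ℚ ∣ ℚ.< ε)
theorem2 _ (inj₁ refl)        = let open Binary in nice-density one two
theorem2 _ (inj₂ (inj₁ refl)) = let open Ternary in nice-density one (two ⊕ one)
theorem2 _ (inj₂ (inj₂ refl)) = let open Quaternary in nice-density one (three ⊕ one)
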